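{- As a formal power series in $z$ with operator coefficients, $$\sum_{r\geq0}\mathcal G_r z^r=\exp\bigl(-\log(1-\delta z)\,E\bigr).$$ Consequently, for every $r\geq1$, $$\mathcal G_r=\frac{\delta^r}{r!}E(E+1)\cdots(E+r-1).$$ Equivalently, on $\mathbb Q[x,y]$, $$r!\,\mathcal G_r=\prod_{j=0}^{r-1}\bigl(xyD+j(y-x)\bigr),$$ where $y-x$ acts by multiplication. In particular, the operators $\mathcal G_r$ commute pairwise.
   Context: Work over $\mathbb Q$. Let $D=\partial_x+\partial_y$, $\mathcal G_0=\mathrm{id}$ and, for $r\geq1$, $\mathcal G_r=y^r\sum_{j=1}^{r}\binom{r-1}{j-1}\frac{x^j}{j!}D^j$. These are differential operators with polynomial coefficients; they act on $\mathbb Q[x,y]$ and on $\mathbb Q(x,y)$. Put $\delta=y-x$ and $u=x/y$, so that $\mathbb Q(x,y)=\mathbb Q(\delta,u)$ with $x=\delta u/(1-u)$, $y=\delta/(1-u)$. $E=u\partial_u$ is the $\mathbb Q$-derivation of $\mathbb Q(\delta,u)$ with $E(\delta)=0$, $E(u)=u$; $\delta$ also denotes the operator of multiplication by $\delta$ (it commutes with $E$). The exponential is $\exp(a(z)E)=\sum_{n\geq0}a(z)^nE^n/n!$ with $a(z)=-\log(1-\delta z)=\sum_{m\ge1}\delta^m z^m/m$; for each power of $z$ only finitely many $n$ contribute. The identities involving $E$ are identities of operators $\mathbb Q[x,y]\to\mathbb Q(x,y)$ (coefficientwise in $z$), where powers of $E$ are computed in $\mathbb Q(x,y)=\mathbb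 Q(\delta,u)$. -}

module Defs where

open import Algebra.Bundles using (CommutativeRing; AbelianGroup)
open import Algebra.Structures using (IsAbelianGroup; IsCommutativeRing)
import Algebra.Properties.CommutativeSemigroup as CommutativeSemigroupProperties
import Algebra.Properties.Monoid.Sum as MonoidSum
import Algebra.Properties.Ring as RingProperties
import Algebra.Properties.Semiring.Exp as SemiringExp
import Algebra.Properties.Semiring.Mult as SemiringMult
import Algebra.Solver.Ring.NaturalCoefficients.Default as RingSolver
open import Data.Empty using (⊥-elim)
open import Data.Fin.Base using (toℕ)
open import Data.Integer.Base using (+_)
open import Data.List.Base using (List; []; _∷_; map)
open import Data.Nat.Base as ℕ using (ℕ; zero; suc; _∸_; _≤_; _!)
open import Data.Nat.Combinatorics using (_C_)
open import Data.Nat.Properties using (_!≢0)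
open import Data.Product.Base using (∃-syntax; _,_)
open import Data.Rational.Base as ℚ using (ℚ; 0ℚ; 1ℚ)
import Data.Rational.Properties as ℚ
open import Function.Base using (id; _∘_)
import Function.Endo.Propositional as Endo
open import Level using (0ℓ; _⊔_) renaming (suc to lsuc)
open import Relation.Binary.PropositionalEquality as ≡ using (_≡_)
import Relation.Binary.Reasoning.Setoid as SetoidReasoning
open import Relation.Nullary.Decidable using (Dec; yes; no; from-no; map′; _×-dec_)
open import Relation.Nullary.Negation using (¬_)

record IntegralDomain c ℓ : Set (lsuc (c ⊔ ℓ)) where
  field
    commutativeRing : CommutativeRing c ℓ
  open CommutativeRing commutativeRing public
  field
    _≈0?      : ∀ a → Dec (a ≈ 0#)
    1≉0       : ¬ 1# ≈ 0#
    *-nonZero : ∀ {a b} → ¬ a ≈ 0# → ¬ b ≈ 0# → ¬ a * b ≈ 0#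

module _ {c ℓ} (R : CommutativeRing c ℓ) where
  open CommutativeRing R
  open RingProperties ring
  open SetoidReasoning setoid

  record IsDerivation (d : Carrier → Carrier) : Set (c ⊔ ℓ) where
    field
      cong    : ∀ {a b} → a ≈ b → d a ≈ d b
      +-homo  : ∀ a b → d (a + b) ≈ d a + d b
      leibniz : ∀ a b → d (a * b) ≈ d a * b + a * d b

    0-homo : d 0# ≈ 0#
    0-homo = +-identityˡ-unique _ _ (trans (sym (+-homo 0# 0#)) (cong (+-identityʳ 0#)))

    1-homo : d 1# ≈ 0#
    1-homo = +-identityˡ-unique _ _ (begin
      d 1# + d 1#            ≈⟨ +-cong (*-identityʳ _) (*-identityˡ _) ⟨
      d 1# * 1# + 1# * d 1#  ≈⟨ leibniz 1# 1# ⟨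
      d (1# * 1#)            ≈⟨ cong (*-identityʳ 1#) ⟩
      d 1#                   ∎)

    -‿homo : ∀ a → d (- a) ≈ - d a
    -‿homo a = +-inverseˡ-unique _ _ (begin
      d (- a) + d a  ≈⟨ +-homo _ _ ⟨
      d (- a + a)    ≈⟨ cong (-‿inverseˡ a) ⟩
      d 0#           ≈⟨ 0-homo ⟩
      0#             ∎)

  +-isDerivation : ∀ {d e} → IsDerivation d → IsDerivation e → IsDerivation (λ a → d a + e a)
  +-isDerivation {d} {e} d′ e′ = record
    { cong    = λ a≈b → +-cong (D.cong a≈b) (E.cong a≈b)
    ; +-homo  = λ a b → trans (+-cong (D.+-homo a b) (E.+-homo a b)) (interchange _ _ _ _)
    ; leibniz = λ a b → trans (+-cong (D.leibniz a b) (E.leibniz a b))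
        (solve 6 (λ a b da db ea eb →
          (da :* b :+ a :* db) :+ (ea :* b :+ a :* eb) := (da :+ ea) :* b :+ a :* (db :+ eb))
          refl a b (d a) (d b) (e a) (e b))
    }
    where
    module D = IsDerivation d′
    module E = IsDerivation e′
    open RingSolver commutativeSemiring using (solve; _:+_; _:*_; _:=_)
    open CommutativeSemigroupProperties +-commutativeSemigroup using (interchange)

  *-isDerivation : ∀ {d} k → IsDerivation d → IsDerivation (λ a → k * d a)
  *-isDerivation {d} k d′ = record
    { cong    = λ a≈b → *-congˡ (D.cong a≈b)
    ; +-homo  = λ a b → trans (*-congˡ (D.+-homo a b)) (distribˡ _ _ _)
    ; leibniz = λ a b → trans (*-congˡ (D.leibniz a b))
        (solve 5 (λ a b da db k → k :* (da :* b :+ a :* db) := (k :* da) :* b :+ a :* (k :* db))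
          refl a b (d a) (d b) k)
    }
    where
    module D = IsDerivation d′
    open RingSolver commutativeSemiring using (solve; _:+_; _:*_; _:=_)

-- R[X]: a polynomial is its list of coefficients, constant term first.
-- Trailing zeros are allowed, and equality is equality of all coefficients.
module Polynomial {c ℓ} (R : CommutativeRing c ℓ) where
  private
    open module R = CommutativeRing R using (Carrier; 0#; 1#)
      renaming (_≈_ to _≈ᴿ_; _+_ to _+ᴿ_; _*_ to _*ᴿ_; -_ to -ᴿ_)
    module RP = RingProperties R.ring

  Poly : Set c
  Poly = List Carrier

  coeff : Poly → ℕ → Carrier
  coeff []      n       = 0#
  coeff (a ∷ p) zero    = a
  coeff (a ∷ p) (suc n) = coeff p n

  infix 4 _≈_
  record _≈_ (p q : Poly) : Set ℓ where
    constructor mk≈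
    field coeff-≈ : ∀ n → coeff p n ≈ᴿ coeff q n
  open _≈_ public

  infixl 6 _+_
  infixl 7 _*_ _·_
  infix  8 -_

  _+_ : Poly → Poly → Poly
  []      + q       = q
  (a ∷ p) + []      = a ∷ p
  (a ∷ p) + (b ∷ q) = (a +ᴿ b) ∷ (p + q)

  -_ : Poly → Poly
  -_ = map -ᴿ_

  _·_ : Carrier → Poly → Poly
  a · p = map (a *ᴿ_) p

  -- (a + X p) q = a q + X (p q)
  _*_ : Poly → Poly → Poly
  []      * q = []
  (a ∷ p) * q = a · q + (0# ∷ p * q)

  const : Carrier → Poly
  const a = a ∷ []

  X : Poly
  X = 0# ∷ 1# ∷ []

  -- d/dX, by the product rule (a + X p)′ = p + X p′
  ∂ : Poly → Poly
  ∂ []      = []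
  ∂ (a ∷ p) = p + (0# ∷ ∂ p)

  coeff-+ : ∀ p q n → coeff (p + q) n ≈ᴿ coeff p n +ᴿ coeff q n
  coeff-+ []      q       n       = R.sym (R.+-identityˡ _)
  coeff-+ (a ∷ p) []      n       = R.sym (R.+-identityʳ _)
  coeff-+ (a ∷ p) (b ∷ q) zero    = R.refl
  coeff-+ (a ∷ p) (b ∷ q) (suc n) = coeff-+ p q n

  coeff-neg : ∀ p n → coeff (- p) n ≈ᴿ -ᴿ coeff p n
  coeff-neg []      n       = R.sym RP.-0#≈0#
  coeff-neg (a ∷ p) zero    = R.refl
  coeff-neg (a ∷ p) (suc n) = coeff-neg p n

  coeff-· : ∀ a p n → coeff (a · p) n ≈ᴿ a *ᴿ coeff p n
  coeff-· a []      n       = R.sym (R.zeroʳ a)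
  coeff-· a (b ∷ p) zero    = R.refl
  coeff-· a (b ∷ p) (suc n) = coeff-· a p n

  ≈-refl : ∀ {p} → p ≈ p
  ≈-refl = mk≈ λ _ → R.refl

  ≈-sym : ∀ {p q} → p ≈ q → q ≈ p
  ≈-sym e = mk≈ λ n → R.sym (coeff-≈ e n)

  ≈-trans : ∀ {p q r} → p ≈ q → q ≈ r → p ≈ r
  ≈-trans e f = mk≈ λ n → R.trans (coeff-≈ e n) (coeff-≈ f n)

  ∷-cong : ∀ {a b p q} → a ≈ᴿ b → p ≈ q → a ∷ p ≈ b ∷ q
  ∷-cong e f = mk≈ λ { zero → e ; (suc n) → coeff-≈ f n }

  ∷-injectiveˡ : ∀ {a b p q} → a ∷ p ≈ b ∷ q → a ≈ᴿ b
  ∷-injectiveˡ e = coeff-≈ e 0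

  ∷-injectiveʳ : ∀ {a b p q} → a ∷ p ≈ b ∷ q → p ≈ q
  ∷-injectiveʳ e = mk≈ λ n → coeff-≈ e (suc n)

  0∷[]≈[] : 0# ∷ [] ≈ []
  0∷[]≈[] = mk≈ λ { zero → R.refl ; (suc n) → R.refl }

  +-isAbelianGroup : IsAbelianGroup _≈_ _+_ [] -_
  +-isAbelianGroup = record
    { isGroup = record
      { isMonoid = record
        { isSemigroup = record
          { isMagma = record
            { isEquivalence = record { refl = ≈-refl ; sym = ≈-sym ; trans = ≈-trans }
            ; ∙-cong = λ {p} {q} {r} {s} e f → mk≈ λ n →
                R.trans (coeff-+ p r n)
                  (R.trans (R.+-cong (coeff-≈ e n) (coeff-≈ f n)) (R.sym (coeff-+ q s n)))
            }
          ; assoc = λ p q r → mk≈ λ n →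
              R.trans (coeff-+ (p + q) r n)
                (R.trans (R.+-congʳ (coeff-+ p q n))
                  (R.trans (R.+-assoc _ _ _)
                    (R.sym (R.trans (coeff-+ p (q + r) n) (R.+-congˡ (coeff-+ q r n))))))
          }
        ; identity = (λ p → ≈-refl)
                   , (λ p → mk≈ λ n → R.trans (coeff-+ p [] n) (R.+-identityʳ _))
        }
      ; inverse = (λ p → mk≈ λ n → R.trans (coeff-+ (- p) p n)
                    (R.trans (R.+-congʳ (coeff-neg p n)) (R.-‿inverseˡ _)))
                , (λ p → mk≈ λ n → R.trans (coeff-+ p (- p) n)
                    (R.trans (R.+-congˡ (coeff-neg p n)) (R.-‿inverseʳ _)))
      ; ⁻¹-cong = λ {p} {q} e → mk≈ λ n → R.trans (coeff-neg p n)
                    (R.trans (R.-‿cong (coeff-≈ e n)) (R.sym (coeff-neg q n)))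
      }
    ; comm = λ p q → mk≈ λ n →
        R.trans (coeff-+ p q n) (R.trans (R.+-comm _ _) (R.sym (coeff-+ q p n)))
    }

  +-abelianGroup : AbelianGroup c ℓ
  +-abelianGroup = record { isAbelianGroup = +-isAbelianGroup }

  private
    module G = AbelianGroup +-abelianGroup
    open CommutativeSemigroupProperties G.commutativeSemigroup
      using (interchange; x∙yz≈y∙xz)
    open SetoidReasoning G.setoid

  +-cong : ∀ {p q r s} → p ≈ q → r ≈ s → p + r ≈ q + s
  +-cong = G.∙-cong

  0∷-+ : ∀ p q → 0# ∷ (p + q) ≈ (0# ∷ p) + (0# ∷ q)
  0∷-+ p q = ∷-cong (R.sym (R.+-identityʳ 0#)) ≈-refl

  ·-cong : ∀ {a b p q} → a ≈ᴿ b → p ≈ q → a · p ≈ b · q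
  ·-cong {a} {b} {p} {q} e f = mk≈ λ n → R.trans (coeff-· a p n)
    (R.trans (R.*-cong e (coeff-≈ f n)) (R.sym (coeff-· b q n)))

  ·-distribˡ : ∀ a p q → a · (p + q) ≈ a · p + a · q
  ·-distribˡ a p q = mk≈ λ n → R.trans (coeff-· a (p + q) n)
    (R.trans (R.*-congˡ (coeff-+ p q n)) (R.trans (R.distribˡ _ _ _)
      (R.sym (R.trans (coeff-+ (a · p) (a · q) n) (R.+-cong (coeff-· a p n) (coeff-· a q n))))))

  ·-distribʳ : ∀ p a b → (a +ᴿ b) · p ≈ a · p + b · p
  ·-distribʳ p a b = mk≈ λ n → R.trans (coeff-· (a +ᴿ b) p n)
    (R.trans (R.distribʳ _ _ _)
      (R.sym (R.trans (coeff-+ (a · p) (b · p) n) (R.+-cong (coeff-· a p n) (coeff-· b p n)))))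

  ·-assoc : ∀ a b p → (a *ᴿ b) · p ≈ a · (b · p)
  ·-assoc a b p = mk≈ λ n → R.trans (coeff-· (a *ᴿ b) p n)
    (R.trans (R.*-assoc _ _ _)
      (R.sym (R.trans (coeff-· a (b · p) n) (R.*-congˡ (coeff-· b p n)))))

  ·-zeroˡ : ∀ p → 0# · p ≈ []
  ·-zeroˡ p = mk≈ λ n → R.trans (coeff-· 0# p n) (R.zeroˡ _)

  ·-identityˡ : ∀ p → 1# · p ≈ p
  ·-identityˡ p = mk≈ λ n → R.trans (coeff-· 1# p n) (R.*-identityˡ _)

  0∷-* : ∀ p q → (0# ∷ p) * q ≈ 0# ∷ p * q
  0∷-* p q = +-cong (·-zeroˡ q) ≈-refl

  const-* : ∀ a q → const a * q ≈ a · q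
  const-* a q = ≈-trans (+-cong ≈-refl 0∷[]≈[]) (G.identityʳ _)

  *-zeroʳ : ∀ p → p * [] ≈ []
  *-zeroʳ []      = ≈-refl
  *-zeroʳ (a ∷ p) = ≈-trans (∷-cong R.refl (*-zeroʳ p)) 0∷[]≈[]

  *-∷ : ∀ p b q → p * (b ∷ q) ≈ b · p + (0# ∷ p * q)
  *-∷ []      b q = ≈-sym 0∷[]≈[]
  *-∷ (a ∷ p) b q = ∷-cong (R.+-congʳ (R.*-comm a b)) (begin
    a · q + p * (b ∷ q)            ≈⟨ +-cong ≈-refl (*-∷ p b q) ⟩
    a · q + (b · p + (0# ∷ p * q)) ≈⟨ x∙yz≈y∙xz (a · q) (b · p) _ ⟩
    b · p + (a · q + (0# ∷ p * q)) ∎)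

  *-comm : ∀ p q → p * q ≈ q * p
  *-comm []      q = ≈-sym (*-zeroʳ q)
  *-comm (a ∷ p) q = begin
    a · q + (0# ∷ p * q) ≈⟨ +-cong ≈-refl (∷-cong R.refl (*-comm p q)) ⟩
    a · q + (0# ∷ q * p) ≈⟨ *-∷ q a p ⟨
    q * (a ∷ p)          ∎

  *-congˡ : ∀ p {q r} → q ≈ r → p * q ≈ p * r
  *-congˡ []      e = ≈-refl
  *-congˡ (a ∷ p) e = +-cong (·-cong R.refl e) (∷-cong R.refl (*-congˡ p e))

  *-cong : ∀ {p q r s} → p ≈ q → r ≈ s → p * r ≈ q * s
  *-cong {p} {q} {r} {s} e f = begin
    p * r ≈⟨ *-congˡ p f ⟩
    p * s ≈⟨ *-comm p s ⟩
    s * p ≈⟨ *-congˡ s e ⟩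
    s * q ≈⟨ *-comm s q ⟩
    q * s ∎

  *-distribʳ : ∀ r p q → (p + q) * r ≈ p * r + q * r
  *-distribʳ r []      q       = ≈-refl
  *-distribʳ r (a ∷ p) []      = ≈-sym (G.identityʳ _)
  *-distribʳ r (a ∷ p) (b ∷ q) = begin
    (a +ᴿ b) · r + (0# ∷ (p + q) * r)
      ≈⟨ +-cong (·-distribʳ r a b) (∷-cong R.refl (*-distribʳ r p q)) ⟩
    (a · r + b · r) + (0# ∷ (p * r + q * r))
      ≈⟨ +-cong ≈-refl (0∷-+ (p * r) (q * r)) ⟩
    (a · r + b · r) + ((0# ∷ p * r) + (0# ∷ q * r))
      ≈⟨ interchange (a · r) (b · r) _ _ ⟩
    (a · r + (0# ∷ p * r)) + (b · r + (0# ∷ q * r)) ∎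

  ·-* : ∀ a p q → (a · p) * q ≈ a · (p * q)
  ·-* a []      q = ≈-refl
  ·-* a (b ∷ p) q = begin
    (a *ᴿ b) · q + (0# ∷ (a · p) * q)
      ≈⟨ +-cong (·-assoc a b q) (∷-cong (R.sym (R.zeroʳ a)) (·-* a p q)) ⟩
    a · (b · q) + a · (0# ∷ p * q)
      ≈⟨ ·-distribˡ a (b · q) (0# ∷ p * q) ⟨
    a · (b · q + (0# ∷ p * q)) ∎

  *-assoc : ∀ p q r → (p * q) * r ≈ p * (q * r)
  *-assoc []      q r = ≈-refl
  *-assoc (a ∷ p) q r = begin
    (a · q + (0# ∷ p * q)) * r        ≈⟨ *-distribʳ r (a · q) _ ⟩
    (a · q) * r + (0# ∷ p * q) * r    ≈⟨ +-cong (·-* a q r) (0∷-* (p * q) r) ⟩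
    a · (q * r) + (0# ∷ (p * q) * r)  ≈⟨ +-cong ≈-refl (∷-cong R.refl (*-assoc p q r)) ⟩
    a · (q * r) + (0# ∷ p * (q * r))  ∎

  *-identityˡ : ∀ p → const 1# * p ≈ p
  *-identityˡ p = ≈-trans (const-* 1# p) (·-identityˡ p)

  isCommutativeRing : IsCommutativeRing _≈_ _+_ _*_ -_ [] (const 1#)
  isCommutativeRing = record
    { isRing = record
      { +-isAbelianGroup = +-isAbelianGroup
      ; *-cong     = *-cong
      ; *-assoc    = *-assoc
      ; *-identity = *-identityˡ , (λ p → ≈-trans (*-comm p _) (*-identityˡ p))
      ; distrib    = (λ p q r → ≈-trans (*-comm p (q + r))
                       (≈-trans (*-distribʳ p q r) (+-cong (*-comm q p) (*-comm r p))))
                   , *-distribʳ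
      }
    ; *-comm = *-comm
    }

  commutativeRing : CommutativeRing c ℓ
  commutativeRing = record { isCommutativeRing = isCommutativeRing }

  ∂-+ : ∀ p q → ∂ (p + q) ≈ ∂ p + ∂ q
  ∂-+ []      q       = ≈-refl
  ∂-+ (a ∷ p) []      = ≈-sym (G.identityʳ _)
  ∂-+ (a ∷ p) (b ∷ q) = begin
    (p + q) + (0# ∷ ∂ (p + q))              ≈⟨ +-cong ≈-refl (∷-cong R.refl (∂-+ p q)) ⟩
    (p + q) + (0# ∷ (∂ p + ∂ q))            ≈⟨ +-cong ≈-refl (0∷-+ (∂ p) (∂ q)) ⟩
    (p + q) + ((0# ∷ ∂ p) + (0# ∷ ∂ q))     ≈⟨ interchange p q _ _ ⟩
    (p + (0# ∷ ∂ p)) + (q + (0# ∷ ∂ q))     ∎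

  ∂-· : ∀ a p → ∂ (a · p) ≈ a · ∂ p
  ∂-· a []      = ≈-refl
  ∂-· a (b ∷ p) = begin
    a · p + (0# ∷ ∂ (a · p))  ≈⟨ +-cong ≈-refl (∷-cong (R.sym (R.zeroʳ a)) (∂-· a p)) ⟩
    a · p + a · (0# ∷ ∂ p)    ≈⟨ ·-distribˡ a p (0# ∷ ∂ p) ⟨
    a · (p + (0# ∷ ∂ p))      ∎

  ∂-zero : ∀ p → p ≈ [] → ∂ p ≈ []
  ∂-zero []      e = ≈-refl
  ∂-zero (a ∷ p) e = begin
    p + (0# ∷ ∂ p)  ≈⟨ +-cong p≈0 (∷-cong R.refl (∂-zero p p≈0)) ⟩
    0# ∷ []         ≈⟨ 0∷[]≈[] ⟩
    []              ∎
    where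
    p≈0 : p ≈ []
    p≈0 = mk≈ λ n → coeff-≈ e (suc n)

  ∂-cong : ∀ p q → p ≈ q → ∂ p ≈ ∂ q
  ∂-cong []      q       e = ≈-sym (∂-zero q (≈-sym e))
  ∂-cong (a ∷ p) []      e = ∂-zero (a ∷ p) e
  ∂-cong (a ∷ p) (b ∷ q) e =
    +-cong (∷-injectiveʳ e) (∷-cong R.refl (∂-cong p q (∷-injectiveʳ e)))

  ∂-leibniz : ∀ p q → ∂ (p * q) ≈ ∂ p * q + p * ∂ q
  ∂-leibniz []      q = ≈-refl
  ∂-leibniz (a ∷ p) q = begin
    ∂ (a · q + (0# ∷ p * q))
      ≈⟨ ∂-+ (a · q) _ ⟩
    ∂ (a · q) + (p * q + (0# ∷ ∂ (p * q)))
      ≈⟨ +-cong (∂-· a q) (+-cong ≈-refl (∷-cong R.refl (∂-leibniz p q))) ⟩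
    a · ∂ q + (p * q + (0# ∷ (∂ p * q + p * ∂ q)))
      ≈⟨ +-cong {a · ∂ q} ≈-refl (+-cong {p * q} ≈-refl (0∷-+ (∂ p * q) (p * ∂ q))) ⟩
    a · ∂ q + (p * q + ((0# ∷ ∂ p * q) + (0# ∷ p * ∂ q)))
      ≈⟨ +-cong {a · ∂ q} ≈-refl (G.assoc (p * q) (0# ∷ ∂ p * q) (0# ∷ p * ∂ q)) ⟨
    a · ∂ q + ((p * q + (0# ∷ ∂ p * q)) + (0# ∷ p * ∂ q))
      ≈⟨ x∙yz≈y∙xz (a · ∂ q) (p * q + (0# ∷ ∂ p * q)) (0# ∷ p * ∂ q) ⟩
    (p * q + (0# ∷ ∂ p * q)) + (a · ∂ q + (0# ∷ p * ∂ q))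
      ≈⟨ +-cong (+-cong {p * q} ≈-refl (0∷-* (∂ p) q)) ≈-refl ⟨
    (p * q + (0# ∷ ∂ p) * q) + (a · ∂ q + (0# ∷ p * ∂ q))
      ≈⟨ +-cong (*-distribʳ q p (0# ∷ ∂ p)) ≈-refl ⟨
    (p + (0# ∷ ∂ p)) * q + (a · ∂ q + (0# ∷ p * ∂ q)) ∎

  ∂-isDerivation : IsDerivation commutativeRing ∂
  ∂-isDerivation = record
    { cong    = λ {p} {q} → ∂-cong p q
    ; +-homo  = ∂-+
    ; leibniz = ∂-leibniz
    }

  -- A derivation of R acts on R[X] coefficientwise, with X as a constant.
  module _ {d : Carrier → Carrier} (d′ : IsDerivation R d) where
    private
      module d = IsDerivation d′

    coeff-map : ∀ p n → coeff (map d p) n ≈ᴿ d (coeff p n)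
    coeff-map []      n       = R.sym d.0-homo
    coeff-map (a ∷ p) zero    = R.refl
    coeff-map (a ∷ p) (suc n) = coeff-map p n

    map-+ : ∀ p q → map d (p + q) ≈ map d p + map d q
    map-+ p q = mk≈ λ n → R.trans (coeff-map (p + q) n)
      (R.trans (d.cong (coeff-+ p q n)) (R.trans (d.+-homo _ _)
        (R.sym (R.trans (coeff-+ (map d p) (map d q) n)
          (R.+-cong (coeff-map p n) (coeff-map q n))))))

    map-· : ∀ a q → map d (a · q) ≈ d a · q + a · map d q
    map-· a q = mk≈ λ n → R.trans (coeff-map (a · q) n)
      (R.trans (d.cong (coeff-· a q n)) (R.trans (d.leibniz _ _)
        (R.sym (R.trans (coeff-+ (d a · q) (a · map d q) n)
          (R.+-cong (coeff-· (d a) q n)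
            (R.trans (coeff-· a (map d q) n) (R.*-congˡ (coeff-map q n))))))))

    map-leibniz : ∀ p q → map d (p * q) ≈ map d p * q + p * map d q
    map-leibniz []      q = ≈-refl
    map-leibniz (a ∷ p) q = begin
      map d (a · q + (0# ∷ p * q))
        ≈⟨ map-+ (a · q) _ ⟩
      map d (a · q) + (d 0# ∷ map d (p * q))
        ≈⟨ +-cong (map-· a q) (∷-cong d.0-homo (map-leibniz p q)) ⟩
      (d a · q + a · map d q) + (0# ∷ (map d p * q + p * map d q))
        ≈⟨ +-cong ≈-refl (0∷-+ (map d p * q) (p * map d q)) ⟩
      (d a · q + a · map d q) + ((0# ∷ map d p * q) + (0# ∷ p * map d q))
        ≈⟨ interchange (d a · q) (a · map d q) _ _ ⟩
      (d a · q + (0# ∷ map d p * q)) + (a · map d q + (0# ∷ p * map d q)) ∎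

    map-isDerivation : IsDerivation commutativeRing (map d)
    map-isDerivation = record
      { cong    = λ {p} {q} e → mk≈ λ n → R.trans (coeff-map p n)
                    (R.trans (d.cong (coeff-≈ e n)) (R.sym (coeff-map q n)))
      ; +-homo  = map-+
      ; leibniz = map-leibniz
      }

module PolynomialDomain {c ℓ} (A : IntegralDomain c ℓ) where
  private
    module A = IntegralDomain A
  open Polynomial A.commutativeRing
  open SetoidReasoning (CommutativeRing.setoid commutativeRing)

  private
    0∷-zero : ∀ {a p} → a A.≈ A.0# → p ≈ [] → a ∷ p ≈ []
    0∷-zero e f = ≈-trans (∷-cong e f) 0∷[]≈[]

  _≈0? : ∀ p → Dec (p ≈ [])
  []      ≈0? = yes ≈-refl
  (a ∷ p) ≈0? = map′ (λ (e , f) → 0∷-zero e f)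
    (λ e → coeff-≈ e 0 , mk≈ λ n → coeff-≈ e (suc n)) ((a A.≈0?) ×-dec (p ≈0?))

  private
    *-nonZero₀ : ∀ a p q → ¬ a A.≈ A.0# → ¬ q ≈ [] → ¬ (a ∷ p) * q ≈ []
    *-nonZero₀ a p []      a≉0 q≉0 e = q≉0 ≈-refl
    *-nonZero₀ a p (b ∷ q) a≉0 q≉0 e with b A.≈0?
    ... | no b≉0  =
      A.*-nonZero a≉0 b≉0 (A.trans (A.sym (A.+-identityʳ _)) (coeff-≈ e 0))
    ... | yes b≈0 =
      *-nonZero₀ a p q a≉0 (λ q≈0 → q≉0 (0∷-zero b≈0 q≈0)) (∷-injectiveʳ (begin
        A.0# ∷ (a ∷ p) * q
          ≈⟨ +-cong (≈-trans (·-cong b≈0 (≈-refl {a ∷ p})) (·-zeroˡ (a ∷ p))) ≈-refl ⟨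
        b · (a ∷ p) + (A.0# ∷ (a ∷ p) * q)
          ≈⟨ *-∷ (a ∷ p) b q ⟨
        (a ∷ p) * (b ∷ q)
          ≈⟨ e ⟩
        []
          ≈⟨ 0∷[]≈[] ⟨
        A.0# ∷ [] ∎))

  *-nonZero : ∀ p q → ¬ p ≈ [] → ¬ q ≈ [] → ¬ p * q ≈ []
  *-nonZero []      q p≉0 q≉0 e = p≉0 ≈-refl
  *-nonZero (a ∷ p) q p≉0 q≉0 e with a A.≈0?
  ... | no a≉0  = *-nonZero₀ a p q a≉0 q≉0 e
  ... | yes a≈0 =
    *-nonZero p q (λ p≈0 → p≉0 (0∷-zero a≈0 p≈0)) q≉0 (∷-injectiveʳ (begin
      A.0# ∷ p * q    ≈⟨ 0∷-* p q ⟨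
      (A.0# ∷ p) * q  ≈⟨ *-cong {r = q} (∷-cong a≈0 (≈-refl {p})) ≈-refl ⟨
      (a ∷ p) * q     ≈⟨ e ⟩
      []              ≈⟨ 0∷[]≈[] ⟨
      A.0# ∷ []       ∎))

  integralDomain : IntegralDomain c ℓ
  integralDomain = record
    { commutativeRing = commutativeRing
    ; _≈0?      = _≈0?
    ; 1≉0       = λ e → A.1≉0 (coeff-≈ e 0)
    ; *-nonZero = λ {p} {q} → *-nonZero p q
    }

module FractionField {c ℓ} (A : IntegralDomain c ℓ) where
  private
    open module A = IntegralDomain A using (Carrier; 0#; 1#; 1≉0; *-nonZero)
      renaming (_≈_ to _≈ᴬ_; _+_ to _+ᴬ_; _*_ to _*ᴬ_; -_ to -ᴬ_; _-_ to _-ᴬ_)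
    open RingProperties A.ring
    open SetoidReasoning A.setoid
    open RingSolver A.commutativeSemiring using (solve; _:+_; _:*_; _:=_)

  *-cancelʳ : ∀ {a b c} → ¬ c ≈ᴬ 0# → a *ᴬ c ≈ᴬ b *ᴬ c → a ≈ᴬ b
  *-cancelʳ {a} {b} {c} c≉0 e with (a -ᴬ b) A.≈0?
  ... | yes a-b≈0 = x∙y⁻¹≈ε⇒x≈y a b a-b≈0
  ... | no  a-b≉0 = ⊥-elim (*-nonZero a-b≉0 c≉0 (begin
    (a -ᴬ b) *ᴬ c            ≈⟨ A.distribʳ c a (-ᴬ b) ⟩
    a *ᴬ c +ᴬ (-ᴬ b) *ᴬ c    ≈⟨ A.+-congˡ (-‿distribˡ-* b c) ⟨
    a *ᴬ c -ᴬ b *ᴬ c         ≈⟨ x≈y⇒x∙y⁻¹≈ε e ⟩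
    0#                       ∎))

  infixl 7 _/_[_]
  record Fraction : Set (c ⊔ ℓ) where
    constructor _/_[_]
    field
      num   : Carrier
      den   : Carrier
      den≉0 : ¬ den ≈ᴬ 0#
  open Fraction public

  infix 4 _≈_
  record _≈_ (f g : Fraction) : Set ℓ where
    constructor mk≈
    field cross : num f *ᴬ den g ≈ᴬ num g *ᴬ den f
  open _≈_ public

  infixl 6 _+_
  infixl 7 _*_
  infix  8 -_

  _+_ : Fraction → Fraction → Fraction
  (a / b [ b≉0 ]) + (c / d [ d≉0 ]) = (a *ᴬ d +ᴬ c *ᴬ b) / b *ᴬ d [ *-nonZero b≉0 d≉0 ]

  _*_ : Fraction → Fraction → Fraction
  (a / b [ b≉0 ]) * (c / d [ d≉0 ]) = (a *ᴬ c) / b *ᴬ d [ *-nonZero b≉0 d≉0 ]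

  -_ : Fraction → Fraction
  - (a / b [ b≉0 ]) = (-ᴬ a) / b [ b≉0 ]

  embed : Carrier → Fraction
  embed a = a / 1# [ 1≉0 ]

  private
    mk≈₂ : ∀ {f g} → num f ≈ᴬ num g → den f ≈ᴬ den g → f ≈ g
    mk≈₂ e e′ = mk≈ (A.*-cong e (A.sym e′))

  ≈-refl : ∀ {f} → f ≈ f
  ≈-refl = mk≈ A.refl

  ≈-sym : ∀ {f g} → f ≈ g → g ≈ f
  ≈-sym e = mk≈ (A.sym (cross e))

  ≈-trans : ∀ {f g h} → f ≈ g → g ≈ h → f ≈ h
  ≈-trans {a / b [ _ ]} {a′ / b′ [ b′≉0 ]} {a″ / b″ [ _ ]} e e′ = mk≈ (*-cancelʳ b′≉0 (begin
    (a *ᴬ b″) *ᴬ b′   ≈⟨ solve 3 (λ a b c → (a :* b) :* c := (a :* c) :* b) A.refl a b″ b′ ⟩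
    (a *ᴬ b′) *ᴬ b″   ≈⟨ A.*-congʳ (cross e) ⟩
    (a′ *ᴬ b) *ᴬ b″   ≈⟨ solve 3 (λ a b c → (a :* b) :* c := (a :* c) :* b) A.refl a′ b b″ ⟩
    (a′ *ᴬ b″) *ᴬ b   ≈⟨ A.*-congʳ (cross e′) ⟩
    (a″ *ᴬ b′) *ᴬ b   ≈⟨ solve 3 (λ a b c → (a :* b) :* c := (a :* c) :* b) A.refl a″ b′ b ⟩
    (a″ *ᴬ b) *ᴬ b′   ∎))

  +-cong : ∀ {f f′ g g′} → f ≈ f′ → g ≈ g′ → f + g ≈ f′ + g′
  +-cong {a / b [ _ ]} {a′ / b′ [ _ ]} {c / d [ _ ]} {c′ / d′ [ _ ]} e e′ = mk≈ (begin
    (a *ᴬ d +ᴬ c *ᴬ b) *ᴬ (b′ *ᴬ d′)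
      ≈⟨ solve 6 (λ a b c d b′ d′ → (a :* d :+ c :* b) :* (b′ :* d′)
           := (a :* b′) :* (d :* d′) :+ (c :* d′) :* (b :* b′)) A.refl a b c d b′ d′ ⟩
    (a *ᴬ b′) *ᴬ (d *ᴬ d′) +ᴬ (c *ᴬ d′) *ᴬ (b *ᴬ b′)
      ≈⟨ A.+-cong (A.*-congʳ (cross e)) (A.*-congʳ (cross e′)) ⟩
    (a′ *ᴬ b) *ᴬ (d *ᴬ d′) +ᴬ (c′ *ᴬ d) *ᴬ (b *ᴬ b′)
      ≈⟨ solve 6 (λ a′ b c′ d b′ d′ → (a′ :* b) :* (d :* d′) :+ (c′ :* d) :* (b :* b′)
           := (a′ :* d′ :+ c′ :* b′) :* (b :* d)) A.refl a′ b c′ d b′ d′ ⟩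
    (a′ *ᴬ d′ +ᴬ c′ *ᴬ b′) *ᴬ (b *ᴬ d) ∎)

  *-cong : ∀ {f f′ g g′} → f ≈ f′ → g ≈ g′ → f * g ≈ f′ * g′
  *-cong {a / b [ _ ]} {a′ / b′ [ _ ]} {c / d [ _ ]} {c′ / d′ [ _ ]} e e′ = mk≈ (begin
    (a *ᴬ c) *ᴬ (b′ *ᴬ d′)  ≈⟨ interchange a c b′ d′ ⟩
    (a *ᴬ b′) *ᴬ (c *ᴬ d′)  ≈⟨ A.*-cong (cross e) (cross e′) ⟩
    (a′ *ᴬ b) *ᴬ (c′ *ᴬ d)  ≈⟨ interchange a′ b c′ d ⟩
    (a′ *ᴬ c′) *ᴬ (b *ᴬ d)  ∎)
    where open CommutativeSemigroupProperties A.*-commutativeSemigroup using (interchange)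

  -‿cong : ∀ {f g} → f ≈ g → - f ≈ - g
  -‿cong {a / b [ _ ]} {c / d [ _ ]} e = mk≈ (begin
    -ᴬ a *ᴬ d      ≈⟨ -‿distribˡ-* a d ⟨
    -ᴬ (a *ᴬ d)    ≈⟨ A.-‿cong (cross e) ⟩
    -ᴬ (c *ᴬ b)    ≈⟨ -‿distribˡ-* c b ⟩
    -ᴬ c *ᴬ b      ∎)

  +-comm : ∀ f g → f + g ≈ g + f
  +-comm (a / b [ _ ]) (c / d [ _ ]) = mk≈₂ (A.+-comm _ _) (A.*-comm b d)

  *-comm : ∀ f g → f * g ≈ g * f
  *-comm (a / b [ _ ]) (c / d [ _ ]) = mk≈₂ (A.*-comm a c) (A.*-comm b d)

  +-assoc : ∀ f g h → (f + g) + h ≈ f + (g + h)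
  +-assoc (a / b [ _ ]) (c / d [ _ ]) (e / f [ _ ]) = mk≈₂
    (solve 6 (λ a b c d e f → (a :* d :+ c :* b) :* f :+ e :* (b :* d)
      := a :* (d :* f) :+ (c :* f :+ e :* d) :* b) A.refl a b c d e f)
    (A.*-assoc b d f)

  +-identityˡ : ∀ f → embed 0# + f ≈ f
  +-identityˡ (a / b [ _ ]) = mk≈₂
    (A.trans (A.+-cong (A.zeroˡ b) (A.*-identityʳ a)) (A.+-identityˡ a)) (A.*-identityˡ b)

  -‿inverseˡ : ∀ f → - f + f ≈ embed 0#
  -‿inverseˡ (a / b [ _ ]) = mk≈ (begin
    (-ᴬ a *ᴬ b +ᴬ a *ᴬ b) *ᴬ 1#  ≈⟨ A.*-identityʳ _ ⟩
    -ᴬ a *ᴬ b +ᴬ a *ᴬ b          ≈⟨ A.distribʳ b (-ᴬ a) a ⟨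
    (-ᴬ a +ᴬ a) *ᴬ b             ≈⟨ A.*-congʳ (A.-‿inverseˡ a) ⟩
    0# *ᴬ b                      ≈⟨ A.zeroˡ b ⟩
    0#                           ≈⟨ A.zeroˡ _ ⟨
    0# *ᴬ (b *ᴬ b)               ∎)

  *-assoc : ∀ f g h → (f * g) * h ≈ f * (g * h)
  *-assoc (a / b [ _ ]) (c / d [ _ ]) (e / f [ _ ]) = mk≈₂ (A.*-assoc a c e) (A.*-assoc b d f)

  *-identityˡ : ∀ f → embed 1# * f ≈ f
  *-identityˡ (a / b [ _ ]) = mk≈₂ (A.*-identityˡ a) (A.*-identityˡ b)

  *-distribʳ : ∀ h f g → (f + g) * h ≈ f * h + g * h
  *-distribʳ (e / f [ _ ]) (a / b [ _ ]) (c / d [ _ ]) = mk≈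
    (solve 6 (λ a b c d e f →
      ((a :* d :+ c :* b) :* e) :* ((b :* f) :* (d :* f))
      := ((a :* e) :* (d :* f) :+ (c :* e) :* (b :* f)) :* ((b :* d) :* f)) A.refl a b c d e f)

  isCommutativeRing : IsCommutativeRing _≈_ _+_ _*_ -_ (embed 0#) (embed 1#)
  isCommutativeRing = record
    { isRing = record
      { +-isAbelianGroup = record
        { isGroup = record
          { isMonoid = record
            { isSemigroup = record
              { isMagma = record
                { isEquivalence = record { refl = ≈-refl ; sym = ≈-sym ; trans = ≈-trans }
                ; ∙-cong = +-cong
                }
              ; assoc = +-assoc
              }
            ; identity = +-identityˡ
                       , (λ f → ≈-trans (+-comm f (embed 0#)) (+-identityˡ f))
            }
          ; inverse = -‿inverseˡ , (λ f → ≈-trans (+-comm f (- f)) (-‿inverseˡ f))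
          ; ⁻¹-cong = -‿cong
          }
        ; comm = +-comm
        }
      ; *-cong     = *-cong
      ; *-assoc    = *-assoc
      ; *-identity = *-identityˡ , (λ f → ≈-trans (*-comm f (embed 1#)) (*-identityˡ f))
      ; distrib    = (λ f g h → ≈-trans (*-comm f (g + h))
                       (≈-trans (*-distribʳ f g h) (+-cong (*-comm g f) (*-comm h f))))
                   , *-distribʳ
      }
    ; *-comm = *-comm
    }

  commutativeRing : CommutativeRing (c ⊔ ℓ) ℓ
  commutativeRing = record { isCommutativeRing = isCommutativeRing }

  embed-+ : ∀ a b → embed (a +ᴬ b) ≈ embed a + embed b
  embed-+ a b = mk≈₂ (A.sym (A.+-cong (A.*-identityʳ a) (A.*-identityʳ b)))
                     (A.sym (A.*-identityˡ 1#))

  embed-* : ∀ a b → embed (a *ᴬ b) ≈ embed a * embed b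
  embed-* a b = mk≈₂ A.refl (A.sym (A.*-identityˡ 1#))

  embed-cong : ∀ {a b} → a ≈ᴬ b → embed a ≈ embed b
  embed-cong e = mk≈₂ e A.refl

  embed-injective : ∀ {a b} → embed a ≈ embed b → a ≈ᴬ b
  embed-injective e = A.trans (A.sym (A.*-identityʳ _)) (A.trans (cross e) (A.*-identityʳ _))

  -- The extension of a derivation of A to fractions.
  quotientRule : (Carrier → Carrier) → Fraction → Fraction
  quotientRule d (a / b [ b≉0 ]) = (d a *ᴬ b -ᴬ a *ᴬ d b) / b *ᴬ b [ *-nonZero b≉0 b≉0 ]

  module _ {d : Carrier → Carrier} (d′ : IsDerivation A.commutativeRing d) where
    private
      module d = IsDerivation d′

      wronskian : ∀ a b → d a *ᴬ b -ᴬ a *ᴬ d b ≈ᴬ d a *ᴬ b +ᴬ a *ᴬ (-ᴬ d b)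
      wronskian a b = A.+-congˡ (-‿distribʳ-* a (d b))

      -‿leibniz : ∀ a b → -ᴬ d (a *ᴬ b) ≈ᴬ (-ᴬ d a) *ᴬ b +ᴬ a *ᴬ (-ᴬ d b)
      -‿leibniz a b = begin
        -ᴬ d (a *ᴬ b)                      ≈⟨ A.-‿cong (d.leibniz a b) ⟩
        -ᴬ (d a *ᴬ b +ᴬ a *ᴬ d b)          ≈⟨ -‿+-comm _ _ ⟨
        -ᴬ (d a *ᴬ b) +ᴬ -ᴬ (a *ᴬ d b)     ≈⟨ A.+-cong (-‿distribˡ-* _ _) (-‿distribʳ-* _ _) ⟩
        (-ᴬ d a) *ᴬ b +ᴬ a *ᴬ (-ᴬ d b)     ∎

      drop-0 : ∀ {s t u} → u ≈ᴬ 0# → s +ᴬ t *ᴬ u ≈ᴬ s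
      drop-0 e = A.trans (A.+-congˡ (A.trans (A.*-congˡ e) (A.zeroʳ _))) (A.+-identityʳ _)

      clear : ∀ a b b′ → (d a *ᴬ b +ᴬ a *ᴬ (-ᴬ d b)) *ᴬ (b′ *ᴬ b′) +ᴬ (a *ᴬ b′) *ᴬ d (b *ᴬ b′)
                       ≈ᴬ d (a *ᴬ b′) *ᴬ (b *ᴬ b′)
      clear a b b′ = begin
        (d a *ᴬ b +ᴬ a *ᴬ (-ᴬ d b)) *ᴬ (b′ *ᴬ b′) +ᴬ (a *ᴬ b′) *ᴬ d (b *ᴬ b′)
          ≈⟨ A.+-congˡ (A.*-congˡ (d.leibniz b b′)) ⟩
        (d a *ᴬ b +ᴬ a *ᴬ (-ᴬ d b)) *ᴬ (b′ *ᴬ b′) +ᴬ (a *ᴬ b′) *ᴬ (d b *ᴬ b′ +ᴬ b *ᴬ d b′)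
          ≈⟨ solve 7 (λ a b b′ da db db′ nb →
               (da :* b :+ a :* nb) :* (b′ :* b′) :+ (a :* b′) :* (db :* b′ :+ b :* db′)
               := (da :* b′ :+ a :* db′) :* (b :* b′) :+ (a :* (b′ :* b′)) :* (nb :+ db))
               A.refl a b b′ (d a) (d b) (d b′) (-ᴬ d b) ⟩
        (d a *ᴬ b′ +ᴬ a *ᴬ d b′) *ᴬ (b *ᴬ b′) +ᴬ (a *ᴬ (b′ *ᴬ b′)) *ᴬ (-ᴬ d b +ᴬ d b)
          ≈⟨ drop-0 (A.-‿inverseˡ (d b)) ⟩
        (d a *ᴬ b′ +ᴬ a *ᴬ d b′) *ᴬ (b *ᴬ b′)
          ≈⟨ A.*-congʳ (d.leibniz a b′) ⟨
        d (a *ᴬ b′) *ᴬ (b *ᴬ b′) ∎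

    quotientRule-cong : ∀ {f g} → f ≈ g → quotientRule d f ≈ quotientRule d g
    quotientRule-cong {a / b [ _ ]} {a′ / b′ [ _ ]} e = mk≈ (begin
      (d a *ᴬ b -ᴬ a *ᴬ d b) *ᴬ (b′ *ᴬ b′)
        ≈⟨ A.*-congʳ (wronskian a b) ⟩
      (d a *ᴬ b +ᴬ a *ᴬ (-ᴬ d b)) *ᴬ (b′ *ᴬ b′)
        ≈⟨ +-cancelʳ ((a *ᴬ b′) *ᴬ d (b *ᴬ b′)) _ _ (begin
             (d a *ᴬ b +ᴬ a *ᴬ (-ᴬ d b)) *ᴬ (b′ *ᴬ b′) +ᴬ (a *ᴬ b′) *ᴬ d (b *ᴬ b′)
               ≈⟨ clear a b b′ ⟩
             d (a *ᴬ b′) *ᴬ (b *ᴬ b′)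
               ≈⟨ A.*-cong (d.cong (cross e)) (A.*-comm b b′) ⟩
             d (a′ *ᴬ b) *ᴬ (b′ *ᴬ b)
               ≈⟨ clear a′ b′ b ⟨
             (d a′ *ᴬ b′ +ᴬ a′ *ᴬ (-ᴬ d b′)) *ᴬ (b *ᴬ b) +ᴬ (a′ *ᴬ b) *ᴬ d (b′ *ᴬ b)
               ≈⟨ A.+-congˡ (A.*-cong (cross e) (d.cong (A.*-comm b b′))) ⟨
             (d a′ *ᴬ b′ +ᴬ a′ *ᴬ (-ᴬ d b′)) *ᴬ (b *ᴬ b) +ᴬ (a *ᴬ b′) *ᴬ d (b *ᴬ b′) ∎) ⟩
      (d a′ *ᴬ b′ +ᴬ a′ *ᴬ (-ᴬ d b′)) *ᴬ (b *ᴬ b)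
        ≈⟨ A.*-congʳ (wronskian a′ b′) ⟨
      (d a′ *ᴬ b′ -ᴬ a′ *ᴬ d b′) *ᴬ (b *ᴬ b) ∎)

    quotientRule-+ : ∀ f g → quotientRule d (f + g) ≈ quotientRule d f + quotientRule d g
    quotientRule-+ (a / b [ _ ]) (c / e [ _ ]) = mk≈₂ (begin
      d (a *ᴬ e +ᴬ c *ᴬ b) *ᴬ (b *ᴬ e) -ᴬ (a *ᴬ e +ᴬ c *ᴬ b) *ᴬ d (b *ᴬ e)
        ≈⟨ wronskian _ _ ⟩
      d (a *ᴬ e +ᴬ c *ᴬ b) *ᴬ (b *ᴬ e) +ᴬ (a *ᴬ e +ᴬ c *ᴬ b) *ᴬ (-ᴬ d (b *ᴬ e))
        ≈⟨ A.+-cong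
             (A.*-congʳ (A.trans (d.+-homo _ _) (A.+-cong (d.leibniz a e) (d.leibniz c b))))
             (A.*-congˡ (-‿leibniz b e)) ⟩
      ((d a *ᴬ e +ᴬ a *ᴬ d e) +ᴬ (d c *ᴬ b +ᴬ c *ᴬ d b)) *ᴬ (b *ᴬ e)
        +ᴬ (a *ᴬ e +ᴬ c *ᴬ b) *ᴬ ((-ᴬ d b) *ᴬ e +ᴬ b *ᴬ (-ᴬ d e))
        ≈⟨ solve 10 (λ a b c e da db dc de nb ne →
             ((da :* e :+ a :* de) :+ (dc :* b :+ c :* db)) :* (b :* e)
               :+ (a :* e :+ c :* b) :* (nb :* e :+ b :* ne)
             := (((da :* b :+ a :* nb) :* (e :* e) :+ (dc :* e :+ c :* ne) :* (b :* b))
               :+ (a :* (b :* e)) :* (de :+ ne)) :+ (c :* (b :* e)) :* (db :+ nb))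
             A.refl a b c e (d a) (d b) (d c) (d e) (-ᴬ d b) (-ᴬ d e) ⟩
      (((d a *ᴬ b +ᴬ a *ᴬ (-ᴬ d b)) *ᴬ (e *ᴬ e) +ᴬ (d c *ᴬ e +ᴬ c *ᴬ (-ᴬ d e)) *ᴬ (b *ᴬ b))
        +ᴬ (a *ᴬ (b *ᴬ e)) *ᴬ (d e -ᴬ d e)) +ᴬ (c *ᴬ (b *ᴬ e)) *ᴬ (d b -ᴬ d b)
        ≈⟨ A.trans (drop-0 (A.-‿inverseʳ (d b))) (drop-0 (A.-‿inverseʳ (d e))) ⟩
      (d a *ᴬ b +ᴬ a *ᴬ (-ᴬ d b)) *ᴬ (e *ᴬ e) +ᴬ (d c *ᴬ e +ᴬ c *ᴬ (-ᴬ d e)) *ᴬ (b *ᴬ b)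
        ≈⟨ A.+-cong (A.*-congʳ (wronskian a b)) (A.*-congʳ (wronskian c e)) ⟨
      (d a *ᴬ b -ᴬ a *ᴬ d b) *ᴬ (e *ᴬ e) +ᴬ (d c *ᴬ e -ᴬ c *ᴬ d e) *ᴬ (b *ᴬ b) ∎)
      (*-interchange b e b e)
      where open CommutativeSemigroupProperties A.*-commutativeSemigroup
              using () renaming (interchange to *-interchange)

    quotientRule-leibniz : ∀ f g →
      quotientRule d (f * g) ≈ quotientRule d f * g + f * quotientRule d g
    quotientRule-leibniz (a / b [ _ ]) (c / e [ _ ]) = mk≈ (begin
      (d (a *ᴬ c) *ᴬ (b *ᴬ e) -ᴬ (a *ᴬ c) *ᴬ d (b *ᴬ e)) *ᴬ (((b *ᴬ b) *ᴬ e) *ᴬ (b *ᴬ (e *ᴬ e)))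
        ≈⟨ A.*-congʳ (A.trans (wronskian _ _)
             (A.+-cong (A.*-congʳ (d.leibniz a c)) (A.*-congˡ (-‿leibniz b e)))) ⟩
      ((d a *ᴬ c +ᴬ a *ᴬ d c) *ᴬ (b *ᴬ e) +ᴬ (a *ᴬ c) *ᴬ ((-ᴬ d b) *ᴬ e +ᴬ b *ᴬ (-ᴬ d e)))
        *ᴬ (((b *ᴬ b) *ᴬ e) *ᴬ (b *ᴬ (e *ᴬ e)))
        ≈⟨ solve 8 (λ a b c e da dc nb ne →
             ((da :* c :+ a :* dc) :* (b :* e) :+ (a :* c) :* (nb :* e :+ b :* ne))
               :* (((b :* b) :* e) :* (b :* (e :* e)))
             := (((da :* b :+ a :* nb) :* c) :* (b :* (e :* e))
                 :+ (a :* (dc :* e :+ c :* ne)) :* ((b :* b) :* e))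
               :* ((b :* e) :* (b :* e)))
             A.refl a b c e (d a) (d c) (-ᴬ d b) (-ᴬ d e) ⟩
      (((d a *ᴬ b +ᴬ a *ᴬ (-ᴬ d b)) *ᴬ c) *ᴬ (b *ᴬ (e *ᴬ e))
          +ᴬ (a *ᴬ (d c *ᴬ e +ᴬ c *ᴬ (-ᴬ d e))) *ᴬ ((b *ᴬ b) *ᴬ e))
        *ᴬ ((b *ᴬ e) *ᴬ (b *ᴬ e))
        ≈⟨ A.*-congʳ (A.+-cong (A.*-congʳ (A.*-congʳ (wronskian a b)))
             (A.*-congʳ (A.*-congˡ (wronskian c e)))) ⟨
      (((d a *ᴬ b -ᴬ a *ᴬ d b) *ᴬ c) *ᴬ (b *ᴬ (e *ᴬ e))
          +ᴬ (a *ᴬ (d c *ᴬ e -ᴬ c *ᴬ d e)) *ᴬ ((b *ᴬ b) *ᴬ e))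
        *ᴬ ((b *ᴬ e) *ᴬ (b *ᴬ e)) ∎)

    quotientRule-isDerivation : IsDerivation commutativeRing (quotientRule d)
    quotientRule-isDerivation = record
      { cong    = quotientRule-cong
      ; +-homo  = quotientRule-+
      ; leibniz = quotientRule-leibniz
      }

    quotientRule-embed : ∀ a → quotientRule d (embed a) ≈ embed (d a)
    quotientRule-embed a = mk≈₂ (begin
      d a *ᴬ 1# -ᴬ a *ᴬ d 1#              ≈⟨ wronskian a 1# ⟩
      d a *ᴬ 1# +ᴬ a *ᴬ (-ᴬ d 1#)         ≈⟨ drop-0 (A.trans (A.-‿cong d.1-homo) -0#≈0#) ⟩
      d a *ᴬ 1#                           ≈⟨ A.*-identityʳ (d a) ⟩
      d a                                 ∎) (A.*-identityˡ 1#)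

ℚ-integralDomain : IntegralDomain 0ℓ 0ℓ
ℚ-integralDomain = record
  { commutativeRing = ℚ.+-*-commutativeRing
  ; _≈0?      = λ p → p ℚ.≟ 0ℚ
  ; 1≉0       = λ ()
  ; *-nonZero = λ {p} {q} → nonZero p q
  }
  where
  open ≡.≡-Reasoning
  nonZero : ∀ p q → ¬ p ≡ 0ℚ → ¬ q ≡ 0ℚ → ¬ p ℚ.* q ≡ 0ℚ
  nonZero p q p≢0 q≢0 pq≡0 = p≢0 (begin
    p                    ≡⟨ ℚ.*-identityʳ p ⟨
    p ℚ.* 1ℚ             ≡⟨ ≡.cong (p ℚ.*_) (ℚ.*-inverseʳ q) ⟨
    p ℚ.* (q ℚ.* ℚ.1/ q) ≡⟨ ℚ.*-assoc p q (ℚ.1/ q) ⟨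
    p ℚ.* q ℚ.* ℚ.1/ q   ≡⟨ ≡.cong (ℚ._* ℚ.1/ q) pq≡0 ⟩
    0ℚ ℚ.* ℚ.1/ q        ≡⟨ ℚ.*-zeroˡ (ℚ.1/ q) ⟩
    0ℚ                   ∎)
    where instance _ = ℚ.≢-nonZero q≢0

infixl 7 _/!_
_/!_ : ℕ → ℕ → ℚ
n /! k = ((+ n) ℚ./ (k !)) {{k !≢0}}

module PowerSeries {c ℓ} (R : CommutativeRing c ℓ) where
  open CommutativeRing R
  open MonoidSum +-monoid using (sum⁺-syntax)

  infixl 7 _⊛_
  _⊛_ : (ℕ → Carrier) → (ℕ → Carrier) → ℕ → Carrier
  (a ⊛ b) n = ∑[ i ≤ n ] (a (toℕ i) * b (n ∸ toℕ i))

  one : ℕ → Carrier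
  one zero    = 1#
  one (suc n) = 0#

  infixr 8 _^_
  _^_ : (ℕ → Carrier) → ℕ → ℕ → Carrier
  a ^ zero  = one
  a ^ suc n = a ⊛ (a ^ n)

-- ∏ r L = L 0 ∘ L 1 ∘ ⋯ ∘ L (r - 1)
∏ : ∀ {a} {A : Set a} → ℕ → (ℕ → A → A) → A → A
∏ zero    L = id
∏ (suc r) L = ∏ r L ∘ L r

-- Used for ℚ[x,y] and for ℚ(x,y); ι is the inclusion of ℚ and D is ∂x + ∂y.
module Operators {c ℓ} (R : CommutativeRing c ℓ)
                 (ι : ℚ → CommutativeRing.Carrier R) (x y : CommutativeRing.Carrier R)
                 (D : CommutativeRing.Carrier R → CommutativeRing.Carrier R) where
  open CommutativeRing R
  open SemiringExp semiring public using (_^_)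
  open SemiringMult semiring public using () renaming (_×_ to _•_)
  open MonoidSum +-monoid public using (sum-syntax)
  open Endo Carrier public using () renaming (_^_ to _^∘_)

  record IsℚDerivation (d : Carrier → Carrier) : Set (c ⊔ ℓ) where
    field
      isDerivation : IsDerivation R d
      constant     : ∀ q → d (ι q) ≈ 0#
    open IsDerivation isDerivation public

  -- With r = suc k, the summation index is i = j - 1.
  𝒢 : ℕ → Carrier → Carrier
  𝒢 zero    f = f
  𝒢 (suc k) f = y ^ suc k * ∑[ i < suc k ]
    (ι ((k C toℕ i) /! suc (toℕ i)) * x ^ suc (toℕ i) * (D ^∘ suc (toℕ i)) f)

-- ℚ[x,y] is encoded as ℚ[x][y]: a list, by powers of y, of coefficient lists in x.
module P where
  private
    ℚ[x]-domain : IntegralDomain 0ℓ 0ℓ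
    ℚ[x]-domain = PolynomialDomain.integralDomain ℚ-integralDomain
    module ℚ[x]    = Polynomial (IntegralDomain.commutativeRing ℚ-integralDomain)
    module ℚ[x][y] = Polynomial (IntegralDomain.commutativeRing ℚ[x]-domain)

  integralDomain : IntegralDomain 0ℓ 0ℓ
  integralDomain = PolynomialDomain.integralDomain ℚ[x]-domain

  open IntegralDomain integralDomain public

  ι : ℚ → Carrier
  ι q = ℚ[x][y].const (ℚ[x].const q)

  x y δ : Carrier
  x = ℚ[x][y].const ℚ[x].X
  y = ℚ[x][y].X
  δ = y - x

  ∂x ∂y D : Carrier → Carrier
  ∂x = map ℚ[x].∂
  ∂y = ℚ[x][y].∂
  D f = ∂x f + ∂y f

  ∂x-isDerivation : IsDerivation commutativeRing ∂x
  ∂x-isDerivation = ℚ[x][y].map-isDerivation {ℚ[x].∂} ℚ[x].∂-isDerivation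

  ∂y-isDerivation : IsDerivation commutativeRing ∂y
  ∂y-isDerivation = ℚ[x][y].∂-isDerivation

  D-isDerivation : IsDerivation commutativeRing D
  D-isDerivation = +-isDerivation commutativeRing {∂x} {∂y} ∂x-isDerivation ∂y-isDerivation

  D-ι : ∀ q → D (ι q) ≈ 0#
  D-ι q = ℚ[x][y].≈-trans (ℚ[x][y].∷-cong ℚ[x].0∷[]≈[] ℚ[x][y].≈-refl) ℚ[x][y].0∷[]≈[]

  D-x : D x ≈ 1#
  D-x = ℚ[x][y].∷-cong (ℚ[x].∷-cong ≡.refl ℚ[x].0∷[]≈[]) ℚ[x][y].≈-refl

  D-y : D y ≈ 1#
  D-y = ℚ[x][y].∷-cong ℚ[x].≈-refl
    (ℚ[x][y].≈-trans (ℚ[x][y].∷-cong ℚ[x].0∷[]≈[] ℚ[x][y].≈-refl) ℚ[x][y].0∷[]≈[])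

  D-δ : D δ ≈ 0#
  D-δ = begin
    D (y - x)      ≈⟨ D.+-homo y (- x) ⟩
    D y + D (- x)  ≈⟨ +-congˡ {D y} (D.-‿homo x) ⟩
    D y - D x      ≈⟨ +-cong D-y (-‿cong D-x) ⟩
    1# - 1#        ≈⟨ -‿inverseʳ 1# ⟩
    0#             ∎
    where
    module D = IsDerivation D-isDerivation
    open SetoidReasoning setoid

  y≉0 : ¬ y ≈ 0#
  y≉0 = from-no (y ≈0?)

  δ≉0 : ¬ δ ≈ 0#
  δ≉0 = from-no (δ ≈0?)

  open Operators commutativeRing ι x y D public

private
  module _ {c ℓ} (R : CommutativeRing c ℓ) where
    open CommutativeRing R
    open SetoidReasoning setoid
    open RingSolver commutativeSemiring using (solve; _:*_; _:=_)

    cross-u : ∀ x y {dx dy} → dx ≈ 1# → dy ≈ 1# →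
              x * y * (dx * y - x * dy) * y ≈ x * ((y - x) * (y * y))
    cross-u x y {dx} {dy} dx≈1 dy≈1 = begin
      x * y * (dx * y - x * dy) * y
        ≈⟨ *-congʳ (*-congˡ (+-cong (*-congʳ dx≈1) (-‿cong (*-congˡ dy≈1)))) ⟩
      x * y * (1# * y - x * 1#) * y
        ≈⟨ *-congʳ (*-congˡ (+-cong (*-identityˡ y) (-‿cong (*-identityʳ x)))) ⟩
      x * y * (y - x) * y
        ≈⟨ solve 3 (λ x y δ → x :* y :* δ :* y := x :* (δ :* (y :* y))) refl x y (y - x) ⟩
      x * ((y - x) * (y * y)) ∎

-- P and K stand for ℚ[x,y] and its field of fractions ℚ(x,y).
module K where
  open FractionField P.integralDomain public
    using ( embed; embed-+; embed-*; embed-cong; embed-injective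
          ; quotientRule; quotientRule-isDerivation; quotientRule-embed
          ; _/_[_]; num; den; den≉0; mk≈; cross; commutativeRing)

  open CommutativeRing commutativeRing public

  ι : ℚ → Carrier
  ι q = embed (P.ι q)

  x y δ u : Carrier
  x = embed P.x
  y = embed P.y
  δ = embed P.δ
  u = P.x / P.y [ P.y≉0 ]

  D : Carrier → Carrier
  D = quotientRule P.D

  D-isDerivation : IsDerivation commutativeRing D
  D-isDerivation = quotientRule-isDerivation {P.D} P.D-isDerivation

  D-embed : ∀ f → D (embed f) ≈ embed (P.D f)
  D-embed = quotientRule-embed {P.D} P.D-isDerivation

  open Operators commutativeRing ι x y D public

  -- u∂ᵤ on ℚ(x,y) = ℚ(δ,u), as the ℚ-derivation with the prescribed values on δ and u.
  record IsU∂ᵤ (E : Carrier → Carrier) : Set where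
    field
      isℚDerivation : IsℚDerivation E
      E-δ           : E δ ≈ 0#
      E-u           : E u ≈ u
    open IsℚDerivation isℚDerivation public

  -- Existence: on ℚ(x,y), u∂ᵤ is (xy/(y - x)) (∂x + ∂y).
  U∂ᵤ : Carrier → Carrier
  U∂ᵤ f = (P.x P.* P.y) / P.δ [ P.δ≉0 ] * D f

  U∂ᵤ-isU∂ᵤ : IsU∂ᵤ U∂ᵤ
  U∂ᵤ-isU∂ᵤ = record
    { isℚDerivation = record
      { isDerivation = *-isDerivation commutativeRing {D} k D-isDerivation
      ; constant     = λ q → vanishes (P.ι q) (P.D-ι q)
      }
    ; E-δ = vanishes P.δ P.D-δ
    ; E-u = mk≈ (cross-u P.commutativeRing P.x P.y P.D-x P.D-y)
    }
    where
    k = (P.x P.* P.y) / P.δ [ P.δ≉0 ]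

    vanishes : ∀ f → P.D f P.≈ P.0# → k * D (embed f) ≈ 0#
    vanishes f Df≈0 = trans (*-congˡ {k} (trans (D-embed f) (embed-cong Df≈0))) (zeroʳ k)

open PowerSeries K.commutativeRing public using () renaming (_^_ to _^⟦z⟧_)

-log[1-δz] : ℕ → K.Carrier
-log[1-δz] zero    = K.0#
-log[1-δz] (suc m) = K.ι (+ 1 ℚ./ suc m) K.* K.δ K.^ suc m

-- Formal power series in z whose coefficients are operators ℚ[x,y] → ℚ(x,y).
Op⟦z⟧ : Set
Op⟦z⟧ = ℕ → P.Carrier → K.Carrier

-- The formal sum T 0 + T 1 + ⋯ converges to S: in each degree in z, the partial
-- sums are eventually constant with value the coefficient of S.
_isSumOf_ : Op⟦z⟧ → (ℕ → Op⟦z⟧) → Set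
S isSumOf T = ∀ r → ∃[ N ] (∀ M → N ≤ M → ∀ f → S r f K.≈ ∑[ n < M ] T (toℕ n) r f)
  where open K using (sum-syntax)

-- The n-th summand a(z)ⁿ Eⁿ / n! of exp (a(z) E).
expTerm : (ℕ → K.Carrier) → (K.Carrier → K.Carrier) → ℕ → Op⟦z⟧
expTerm a E n r f = K.ι (1 /! n) K.* ((a ^⟦z⟧ n) r K.* (E K.^∘ n) (K.embed f))

-- Put L j = xyD + jδ. The L j commute, because xyD is a derivation killing δ, and the
-- Pascal-type recurrence (k + 2) C(k+1, i) = (k + i + 2) C(k, i) + (i + 1) C(k, i-1) is exactly
-- (r + 1) 𝒢 (r + 1) = L r ∘ 𝒢 r, so r! 𝒢 r = L 0 ∘ ⋯ ∘ L (r - 1); dividing by r! also gives the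
-- commutation of the 𝒢 r. On ℚ[x,y] the derivations δ E and xyD agree, since they agree on x and
-- y, and δ commutes with E, so the product is δʳ E (E + 1) ⋯ (E + r - 1). For the exponential,
-- a = -log (1 - δz) satisfies (1 - δz) (aⁿ)′ = δ n aⁿ⁻¹; comparing coefficients of zʳ shows that
-- r! ∑ₙ [zʳ] aⁿ Eⁿ / n! obeys the recurrence of δʳ E (E + 1) ⋯ (E + r - 1).
module Submission where

open import Defs
open import Algebra.Bundles using (CommutativeRing)
import Algebra.Properties.CommutativeMonoid.Mult as CommutativeMonoidMult
import Algebra.Properties.CommutativeMonoid.Sum as CommutativeMonoidSum
import Algebra.Properties.CommutativeSemigroup as CommutativeSemigroupProperties
import Algebra.Properties.Monoid.Sum as MonoidSum
import Algebra.Properties.Ring as RingProperties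
import Algebra.Properties.Semiring.Exp as SemiringExp
import Algebra.Properties.Semiring.Mult as SemiringMult
import Algebra.Properties.Semiring.Sum as SemiringSum
import Algebra.Solver.Ring.NaturalCoefficients.Default as RingSolver
open import Data.Fin.Base as Fin using (Fin; toℕ)
open import Data.Integer.Base as ℤ using (+_)
import Data.Integer.Properties as ℤ
open import Data.List.Base using ([]; _∷_)
open import Data.Nat.Base as ℕ using (ℕ; zero; suc; _∸_; _≤_; z≤n; s≤s; _!; NonZero)
open import Data.Nat.Combinatorics using (_C_; nCk+nC[k+1]≡[n+1]C[k+1]; nC1≡n)
open import Data.Nat.Combinatorics.Specification using (k>n⇒nCk≡0)
import Data.Nat.Properties as ℕ
import Data.Nat.Solver as ℕSolver
open import Data.Product.Base using (_×_; _,_)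
open import Data.Rational.Base as ℚ using (ℚ; 0ℚ; 1ℚ)
import Data.Rational.Properties as ℚ
open import Data.Rational.Unnormalised.Base as ℚᵘ using (mkℚᵘ; *≡*)
import Data.Rational.Unnormalised.Properties as ℚᵘ
open import Function.Base using (_∘_)
import Function.Endo.Propositional as Endo
open import Level using (_⊔_)
open import Relation.Binary.PropositionalEquality as ≡ using (_≡_)
import Relation.Binary.Reasoning.Setoid as SetoidReasoning

-- Binomial identities.

-- Induction on `n` by Pascal's rule. Moving `k * C(n,k)` to the right avoids truncated subtraction,
-- so that no bound on `k` is needed in the induction.
[n-k]*nCk≡[k+1]*nC[k+1] : ∀ n k → n ℕ.* (n C k) ≡ k ℕ.* (n C k) ℕ.+ suc k ℕ.* (n C suc k)
[n-k]*nCk≡[k+1]*nC[k+1] zero    zero    = ≡.refl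
[n-k]*nCk≡[k+1]*nC[k+1] zero    (suc k) = ≡.sym (≡.cong₂ ℕ._+_ (ℕ.*-zeroʳ k) (ℕ.*-zeroʳ k))
[n-k]*nCk≡[k+1]*nC[k+1] (suc n) zero    =
  ≡.trans (ℕ.*-identityʳ (suc n)) (≡.sym (≡.trans (ℕ.*-identityˡ _) (nC1≡n (suc n))))
[n-k]*nCk≡[k+1]*nC[k+1] (suc n) (suc k)
  rewrite ≡.sym (nCk+nC[k+1]≡[n+1]C[k+1] n k) | ≡.sym (nCk+nC[k+1]≡[n+1]C[k+1] n (suc k)) = begin
  suc n ℕ.* (a ℕ.+ b)
    ≡⟨ solve 3 (λ n a b → (con 1 :+ n) :* (a :+ b) := (n :* a :+ n :* b) :+ (a :+ b)) ≡.refl n a b ⟩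
  (n ℕ.* a ℕ.+ n ℕ.* b) ℕ.+ (a ℕ.+ b)
    ≡⟨ ≡.cong (ℕ._+ (a ℕ.+ b)) (≡.cong₂ ℕ._+_
         ([n-k]*nCk≡[k+1]*nC[k+1] n k) ([n-k]*nCk≡[k+1]*nC[k+1] n (suc k))) ⟩
  ((k ℕ.* a ℕ.+ suc k ℕ.* b) ℕ.+ (suc k ℕ.* b ℕ.+ suc (suc k) ℕ.* c)) ℕ.+ (a ℕ.+ b)
    ≡⟨ solve 4 (λ k a b c →
         ((k :* a :+ (con 1 :+ k) :* b) :+ ((con 1 :+ k) :* b :+ (con 2 :+ k) :* c)) :+ (a :+ b)
         := (con 1 :+ k) :* (a :+ b) :+ (con 2 :+ k) :* (b :+ c)) ≡.refl k a b c ⟩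
  suc k ℕ.* (a ℕ.+ b) ℕ.+ suc (suc k) ℕ.* (b ℕ.+ c) ∎
  where
  open ≡.≡-Reasoning
  open ℕSolver.+-*-Solver
  a = n C k
  b = n C suc k
  c = n C suc (suc k)

-- After Pascal's rule, the only product not already of the required form is `n * C(n,k)`, which the
-- preceding identity trades for multiples of `C(n,k)` and `C(n,k+1)` with coefficients free of `n`.
[n+2]*[n+1]C[k+1] : ∀ n k → suc (suc n) ℕ.* (suc n C suc k)
                  ≡ (suc (suc k) ℕ.+ suc n) ℕ.* (n C suc k) ℕ.+ (n C k) ℕ.* suc (suc k)
[n+2]*[n+1]C[k+1] n k rewrite ≡.sym (nCk+nC[k+1]≡[n+1]C[k+1] n k) = begin
  suc (suc n) ℕ.* (a ℕ.+ b)
    ≡⟨ solve 3 (λ n a b → (con 2 :+ n) :* (a :+ b)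
         := n :* a :+ (con 2 :* a :+ (con 2 :+ n) :* b)) ≡.refl n a b ⟩
  n ℕ.* a ℕ.+ (2 ℕ.* a ℕ.+ suc (suc n) ℕ.* b)
    ≡⟨ ≡.cong (ℕ._+ (2 ℕ.* a ℕ.+ suc (suc n) ℕ.* b)) ([n-k]*nCk≡[k+1]*nC[k+1] n k) ⟩
  (k ℕ.* a ℕ.+ suc k ℕ.* b) ℕ.+ (2 ℕ.* a ℕ.+ suc (suc n) ℕ.* b)
    ≡⟨ solve 4 (λ n k a b →
         (k :* a :+ (con 1 :+ k) :* b) :+ (con 2 :* a :+ (con 2 :+ n) :* b)
         := ((con 2 :+ k) :+ (con 1 :+ n)) :* b :+ a :* (con 2 :+ k)) ≡.refl n k a b ⟩
  (suc (suc k) ℕ.+ suc n) ℕ.* b ℕ.+ a ℕ.* suc (suc k) ∎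
  where
  open ≡.≡-Reasoning
  open ℕSolver.+-*-Solver
  a = n C k
  b = n C suc k

-- Arithmetic of rational fractions.

-- Passing through unnormalised fractions reduces equality to cross-multiplication, without
-- unfolding the gcd normalisation in `ℚ./`.
/-cong : ∀ a b c d .{{_ : NonZero b}} .{{_ : NonZero d}} → a ℕ.* d ≡ c ℕ.* b → + a ℚ./ b ≡ + c ℚ./ d
/-cong a (suc b) c (suc d) ad≡cb = ℚ.fromℚᵘ-cong {mkℚᵘ (+ a) b} {mkℚᵘ (+ c) d} (*≡* (begin
  + a ℤ.* + suc d      ≡⟨ ℤ.pos-* a (suc d) ⟨
  + (a ℕ.* suc d)      ≡⟨ ≡.cong +_ ad≡cb ⟩
  + (c ℕ.* suc b)      ≡⟨ ℤ.pos-* c (suc b) ⟩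
  + c ℤ.* + suc b      ∎))
  where open ≡.≡-Reasoning

/-+ : ∀ a b d .{{_ : NonZero d}} → + (a ℕ.+ b) ℚ./ d ≡ + a ℚ./ d ℚ.+ + b ℚ./ d
/-+ a b (suc d) = ℚ.toℚᵘ-injective (begin
  ℚ.toℚᵘ (+ (a ℕ.+ b) ℚ./ suc d)                     ≈⟨ ℚ.toℚᵘ-fromℚᵘ (mkℚᵘ (+ (a ℕ.+ b)) d) ⟩
  mkℚᵘ (+ (a ℕ.+ b)) d                               ≈⟨ *≡* cross ⟩
  mkℚᵘ (+ a) d ℚᵘ.+ mkℚᵘ (+ b) d
    ≈⟨ ℚᵘ.+-cong (ℚ.toℚᵘ-fromℚᵘ (mkℚᵘ (+ a) d)) (ℚ.toℚᵘ-fromℚᵘ (mkℚᵘ (+ b) d)) ⟨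
  ℚ.toℚᵘ (+ a ℚ./ suc d) ℚᵘ.+ ℚ.toℚᵘ (+ b ℚ./ suc d) ≈⟨ ℚ.toℚᵘ-homo-+ (+ a ℚ./ suc d) (+ b ℚ./ suc d) ⟨
  ℚ.toℚᵘ (+ a ℚ./ suc d ℚ.+ + b ℚ./ suc d)           ∎)
  where
  open SetoidReasoning ℚᵘ.≃-setoid
  cross : + (a ℕ.+ b) ℤ.* (+ suc d ℤ.* + suc d) ≡ (+ a ℤ.* + suc d ℤ.+ + b ℤ.* + suc d) ℤ.* + suc d
  cross = ≡.trans (≡.sym (ℤ.*-assoc (+ (a ℕ.+ b)) (+ suc d) (+ suc d)))
    (≡.cong (ℤ._* + suc d) (ℤ.*-distribʳ-+ (+ suc d) (+ a) (+ b)))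

-- Additive operators and their ordered products.

module AdditiveOperators {c ℓ} (R : CommutativeRing c ℓ) where
  open CommutativeRing R hiding (zero)
  open SemiringExp semiring using (_^_)
  open SemiringMult semiring renaming (_×_ to _•_)
  open MonoidSum +-monoid using (sum-syntax)
  open CommutativeMonoidMult +-commutativeMonoid using () renaming (×-distrib-+ to •-distrib-+)
  open CommutativeSemigroupProperties +-commutativeSemigroup using (interchange)
  open RingProperties ring
  open SetoidReasoning setoid

  -- Additivity is what remains of a derivation once a multiplication operator is added to it, as in
  -- `E ⊞ j`.
  record IsAdditive (L : Carrier → Carrier) : Set (c ⊔ ℓ) where
    field
      cong   : ∀ {a b} → a ≈ b → L a ≈ L b
      +-homo : ∀ a b → L (a + b) ≈ L a + L b

    0-homo : L 0# ≈ 0#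
    0-homo = +-identityˡ-unique _ _ (trans (sym (+-homo 0# 0#)) (cong (+-identityʳ 0#)))

    •-homo : ∀ n a → L (n • a) ≈ n • L a
    •-homo zero    a = 0-homo
    •-homo (suc n) a = trans (+-homo a (n • a)) (+-congˡ (•-homo n a))

    sum-homo : ∀ n (f : Fin n → Carrier) → L (∑[ i < n ] f i) ≈ ∑[ i < n ] L (f i)
    sum-homo zero    f = 0-homo
    sum-homo (suc n) f = trans (+-homo _ _) (+-congˡ (sum-homo n (f ∘ Fin.suc)))

  derivation-isAdditive : ∀ {d} → IsDerivation R d → IsAdditive d
  derivation-isAdditive d′ = record { cong = cong ; +-homo = +-homo }
    where open IsDerivation d′

  *-isAdditive : ∀ k → IsAdditive (k *_)
  *-isAdditive k = record { cong = *-congˡ ; +-homo = distribˡ k }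

  •-isAdditive : ∀ n → IsAdditive (n •_)
  •-isAdditive n = record { cong = ×-congʳ n ; +-homo = λ a b → •-distrib-+ a b n }

  ∘-isAdditive : ∀ {L M} → IsAdditive L → IsAdditive M → IsAdditive (L ∘ M)
  ∘-isAdditive L′ M′ = record
    { cong   = λ a≈b → L.cong (M.cong a≈b)
    ; +-homo = λ a b → trans (L.cong (M.+-homo a b)) (L.+-homo _ _)
    }
    where
    module L = IsAdditive L′
    module M = IsAdditive M′

  +-isAdditive : ∀ {L M} → IsAdditive L → IsAdditive M → IsAdditive (λ a → L a + M a)
  +-isAdditive L′ M′ = record
    { cong   = λ a≈b → +-cong (L.cong a≈b) (M.cong a≈b)
    ; +-homo = λ a b → trans (+-cong (L.+-homo a b) (M.+-homo a b)) (interchange _ _ _ _)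
    }
    where
    module L = IsAdditive L′
    module M = IsAdditive M′

  infixl 6 _⊞_
  _⊞_ : (Carrier → Carrier) → ℕ → Carrier → Carrier
  (E ⊞ j) a = E a + j • a

  ⊞-isAdditive : ∀ {E} → IsAdditive E → ∀ j → IsAdditive (E ⊞ j)
  ⊞-isAdditive E′ j = +-isAdditive E′ (•-isAdditive j)

  ∏-isAdditive : ∀ {L} → (∀ j → IsAdditive (L j)) → ∀ r → IsAdditive (∏ r L)
  ∏-isAdditive L′ zero    = record { cong = λ a≈b → a≈b ; +-homo = λ _ _ → refl }
  ∏-isAdditive L′ (suc r) = ∘-isAdditive (∏-isAdditive L′ r) (L′ r)

  -- `h` passes one factor at a time, the innermost first. It serves with `h` a multiplication by a
  -- constant, an operator commuting with every factor, and the inclusion of polynomials in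
  -- fractions.
  ∏-intertwine : ∀ {b} {B : Set b} {L : ℕ → Carrier → Carrier} {M : ℕ → B → B} {h : B → Carrier} →
                 (∀ j → IsAdditive (L j)) → (∀ j a → L j (h a) ≈ h (M j a)) →
                 ∀ r a → ∏ r L (h a) ≈ h (∏ r M a)
  ∏-intertwine L′ Lh≈hM zero    a = refl
  ∏-intertwine L′ Lh≈hM (suc r) a = trans
    (IsAdditive.cong (∏-isAdditive L′ r) (Lh≈hM r a)) (∏-intertwine L′ Lh≈hM r _)

  -- Each operator receives one factor `k`. The induction leaves one `k` outside on the left, and
  -- `∏-intertwine` carries it inwards to the innermost operator `L r`.
  ∏-scale : ∀ {L} k → (∀ j → IsAdditive (L j)) → (∀ j a → L j (k * a) ≈ k * L j a) →
            ∀ r a → k ^ r * ∏ r L a ≈ ∏ r (λ j a → k * L j a) a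
  ∏-scale         k L′ Lk≈kL zero    a = *-identityˡ a
  ∏-scale {L = L} k L′ Lk≈kL (suc r) a = begin
    k * k ^ r * ∏ r L (L r a)               ≈⟨ *-assoc k (k ^ r) _ ⟩
    k * (k ^ r * ∏ r L (L r a))             ≈⟨ *-congˡ (∏-scale k L′ Lk≈kL r (L r a)) ⟩
    k * ∏ r (λ j a → k * L j a) (L r a)     ≈⟨ ∏-intertwine (λ j → ∘-isAdditive (*-isAdditive k) (L′ j))
                                                 (λ j a → *-congˡ (Lk≈kL j a)) r (L r a) ⟨
    ∏ r (λ j a → k * L j a) (k * L r a)     ∎

-- Division by positive integers.

module ℚModule {c ℓ} (R : CommutativeRing c ℓ) (ι : ℚ → CommutativeRing.Carrier R)
  (ι-+ : ∀ p q → CommutativeRing._≈_ R (ι (p ℚ.+ q)) (CommutativeRing._+_ R (ι p) (ι q)))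
  (ι-1 : CommutativeRing._≈_ R (ι 1ℚ) (CommutativeRing.1# R)) where
  open CommutativeRing R hiding (zero)
  open SemiringMult semiring renaming (_×_ to _•_)
  open RingProperties ring
  open SetoidReasoning setoid

  -- Induction on the numerator by additivity of `ι`. For numerator zero, the image added to itself
  -- gives itself, hence is zero.
  ι-/ : ∀ n d .{{_ : NonZero d}} → ι (+ n ℚ./ d) ≈ n • ι (+ 1 ℚ./ d)
  ι-/ zero    d = +-identityˡ-unique _ _ (begin
    ι (+ 0 ℚ./ d) + ι (+ 0 ℚ./ d)  ≈⟨ ι-+ _ _ ⟨
    ι (+ 0 ℚ./ d ℚ.+ + 0 ℚ./ d)    ≡⟨ ≡.cong ι (/-+ 0 0 d) ⟨
    ι (+ 0 ℚ./ d)                  ∎)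
  ι-/ (suc n) d = begin
    ι (+ suc n ℚ./ d)              ≡⟨ ≡.cong ι (/-+ 1 n d) ⟩
    ι (+ 1 ℚ./ d ℚ.+ + n ℚ./ d)    ≈⟨ ι-+ _ _ ⟩
    ι (+ 1 ℚ./ d) + ι (+ n ℚ./ d)  ≈⟨ +-congˡ (ι-/ n d) ⟩
    suc n • ι (+ 1 ℚ./ d)          ∎

  •-ι-1/ : ∀ n .{{_ : NonZero n}} → n • ι (+ 1 ℚ./ n) ≈ 1#
  •-ι-1/ n@(suc _) = begin
    n • ι (+ 1 ℚ./ n)  ≈⟨ ι-/ n n ⟨
    ι (+ n ℚ./ n)      ≡⟨ ≡.cong ι (/-cong n n 1 1 (ℕ.*-comm n 1)) ⟩
    ι 1ℚ               ≈⟨ ι-1 ⟩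
    1#                 ∎

  -- Multiplication by `ι (1/n)` inverts `n •_`. This divides the recurrences below by their leading
  -- factor `suc r`.
  •-cancel : ∀ n .{{_ : NonZero n}} {a b} → n • a ≈ n • b → a ≈ b
  •-cancel n {a} {b} na≈nb = begin
    a                        ≈⟨ unit a ⟨
    ι (+ 1 ℚ./ n) * (n • a)  ≈⟨ *-congˡ na≈nb ⟩
    ι (+ 1 ℚ./ n) * (n • b)  ≈⟨ unit b ⟩
    b                        ∎
    where
    unit : ∀ a → ι (+ 1 ℚ./ n) * (n • a) ≈ a
    unit a = begin
      ι (+ 1 ℚ./ n) * (n • a)  ≈⟨ ×-comm-* n _ a ⟩
      n • (ι (+ 1 ℚ./ n) * a)  ≈⟨ ×-assoc-* n _ a ⟨
      n • ι (+ 1 ℚ./ n) * a    ≈⟨ *-congʳ (•-ι-1/ n) ⟩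
      1# * a                   ≈⟨ *-identityˡ a ⟩
      a                        ∎

  1/!_ : ℕ → Carrier
  1/! k = ι (1 /! k)

  ι-/! : ∀ n k → ι (n /! k) ≈ n • 1/! k
  ι-/! n k = ι-/ n (k !) {{k ℕ.!≢0}}

  !•1/! : ∀ k → (k !) • 1/! k ≈ 1#
  !•1/! k = •-ι-1/ (k !) {{k ℕ.!≢0}}

  suc•1/!suc : ∀ k → suc k • 1/! suc k ≈ 1/! k
  suc•1/!suc k = trans (sym (ι-/! (suc k) (suc k))) (reflexive (≡.cong ι
    (/-cong (suc k) (suc k !) 1 (k !) {{suc k ℕ.!≢0}} {{k ℕ.!≢0}} (≡.sym (ℕ.*-identityˡ (suc k !))))))

  -- Turns a repeated sum into a product, so that the ring solver can treat the integer `n • 1#` as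
  -- an atom.
  •1 : ∀ n a → n • a ≈ n • 1# * a
  •1 n a = trans (×-congʳ n (sym (*-identityˡ a))) (sym (×-assoc-* n 1# a))

-- Finite sums.

module _ {c ℓ} (R : CommutativeRing c ℓ) where
  open CommutativeRing R hiding (zero)
  open MonoidSum +-monoid using (sum-syntax)
  open SetoidReasoning setoid

  -- The bound on `i` is handed to the summands because `θ-⊛` must rewrite `n` as `i + (n ∸ i)`.
  sum-cong : ∀ n (f g : ℕ → Carrier) → (∀ i → i ℕ.< n → f i ≈ g i) →
             ∑[ i < n ] f (toℕ i) ≈ ∑[ i < n ] g (toℕ i)
  sum-cong zero    f g f≈g = refl
  sum-cong (suc n) f g f≈g = +-cong (f≈g 0 (s≤s z≤n))
    (sum-cong n (f ∘ suc) (g ∘ suc) (λ i i<n → f≈g (suc i) (s≤s i<n)))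

  sum-last : ∀ n (f : ℕ → Carrier) → ∑[ i < suc n ] f (toℕ i) ≈ ∑[ i < n ] f (toℕ i) + f n
  sum-last zero    f = +-comm _ _
  sum-last (suc n) f = trans (+-congˡ (sum-last n (f ∘ suc))) (sym (+-assoc _ _ _))

-- The operators `L j` and `𝒢 r` over a differential ring.

module DifferentialAlgebra {c ℓ} (R : CommutativeRing c ℓ) (ι : ℚ → CommutativeRing.Carrier R)
  (ι-+ : ∀ p q → CommutativeRing._≈_ R (ι (p ℚ.+ q)) (CommutativeRing._+_ R (ι p) (ι q)))
  (ι-1 : CommutativeRing._≈_ R (ι 1ℚ) (CommutativeRing.1# R))
  (x y : CommutativeRing.Carrier R) (D : CommutativeRing.Carrier R → CommutativeRing.Carrier R)
  (D-isDerivation : IsDerivation R D)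
  (D-ι : ∀ q → CommutativeRing._≈_ R (D (ι q)) (CommutativeRing.0# R))
  (D-x : CommutativeRing._≈_ R (D x) (CommutativeRing.1# R))
  (D-y : CommutativeRing._≈_ R (D y) (CommutativeRing.1# R)) where
  open CommutativeRing R hiding (zero)
  open Operators R ι x y D
  open SemiringMult semiring hiding (_×_)
  open ℚModule R ι ι-+ ι-1
  open AdditiveOperators R
  open CommutativeMonoidSum +-commutativeMonoid using (∑-distrib-+)
  open RingSolver commutativeSemiring using (solve; _:+_; _:*_; _:=_; con)
  open SetoidReasoning setoid
  private
    module D = IsDerivation D-isDerivation
    module D′ = IsAdditive (derivation-isAdditive D-isDerivation)

    δ : Carrier
    δ = y - x

    D-δ : D δ ≈ 0#
    D-δ = begin
      D (y - x)      ≈⟨ D.+-homo y (- x) ⟩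
      D y + D (- x)  ≈⟨ +-congˡ (D.-‿homo x) ⟩
      D y - D x      ≈⟨ +-cong D-y (-‿cong D-x) ⟩
      1# - 1#        ≈⟨ -‿inverseʳ 1# ⟩
      0#             ∎

  y≈δ+x : y ≈ δ + x
  y≈δ+x = sym (trans (+-assoc y (- x) x) (trans (+-congˡ (-‿inverseˡ x)) (+-identityʳ y)))

  D-constant* : ∀ {k} → D k ≈ 0# → ∀ a → D (k * a) ≈ k * D a
  D-constant* {k} Dk≈0 a = begin
    D (k * a)          ≈⟨ D.leibniz k a ⟩
    D k * a + k * D a  ≈⟨ +-congʳ (trans (*-congʳ Dk≈0) (zeroˡ a)) ⟩
    0# + k * D a       ≈⟨ +-identityˡ _ ⟩
    k * D a            ∎

  D-^ : ∀ {t} → D t ≈ 1# → ∀ n → D (t ^ suc n) ≈ suc n • 1# * t ^ n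
  D-^ {t} Dt≈1 zero = begin
    D (t * 1#)          ≈⟨ D.cong (*-identityʳ t) ⟩
    D t                 ≈⟨ Dt≈1 ⟩
    1#                  ≈⟨ solve 0 (con 1 := (con 1 :+ con 0) :* con 1) refl ⟩
    1 • 1# * 1#         ∎
  D-^ {t} Dt≈1 (suc n) = begin
    D (t * t ^ suc n)                          ≈⟨ D.leibniz _ _ ⟩
    D t * t ^ suc n + t * D (t ^ suc n)        ≈⟨ +-cong (*-congʳ Dt≈1) (*-congˡ (D-^ Dt≈1 n)) ⟩
    1# * (t * t ^ n) + t * (suc n • 1# * t ^ n)
      ≈⟨ solve 3 (λ t p ν → con 1 :* (t :* p) :+ t :* (ν :* p) := (con 1 :+ ν) :* (t :* p))
           refl t (t ^ n) (suc n • 1#) ⟩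
    suc (suc n) • 1# * t ^ suc n               ∎

  L : ℕ → Carrier → Carrier
  L j g = x * y * D g + j • (δ * g)

  L-isAdditive : ∀ j → IsAdditive (L j)
  L-isAdditive j = +-isAdditive
    (∘-isAdditive (*-isAdditive (x * y)) (derivation-isAdditive D-isDerivation))
    (∘-isAdditive (•-isAdditive j) (*-isAdditive δ))

  L-constant* : ∀ {k} → D k ≈ 0# → ∀ j a → L j (k * a) ≈ k * L j a
  L-constant* {k} Dk≈0 j a = begin
    x * y * D (k * a) + j • (δ * (k * a))
      ≈⟨ +-cong (*-congˡ (D-constant* Dk≈0 a)) (•1 j _) ⟩
    x * y * (k * D a) + j • 1# * (δ * (k * a))
      ≈⟨ solve 6 (λ xy k a da ν δ → xy :* (k :* da) :+ ν :* (δ :* (k :* a))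
           := k :* (xy :* da :+ ν :* (δ :* a))) refl (x * y) k a (D a) (j • 1#) δ ⟩
    k * (x * y * D a + j • 1# * (δ * a))
      ≈⟨ *-congˡ (+-congˡ (•1 j _)) ⟨
    k * L j a ∎

  -- Since `D δ` vanishes, both composites have the same second-order term, and the rest is
  -- symmetric in `i` and `j`. `D (x * y * D a)` stays an atom for the solver.
  L-comm : ∀ i j a → L i (L j a) ≈ L j (L i a)
  L-comm i j a = begin
    L i (L j a)  ≈⟨ expand i j ⟩
    _            ≈⟨ solve 7 (λ xy δ a da dda μ ν →
                      xy :* (dda :+ ν :* (δ :* da)) :+ μ :* (δ :* (xy :* da :+ ν :* (δ :* a)))
                      := xy :* (dda :+ μ :* (δ :* da)) :+ ν :* (δ :* (xy :* da :+ μ :* (δ :* a))))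
                      refl (x * y) δ a (D a) (D (x * y * D a)) (i • 1#) (j • 1#) ⟩
    _            ≈⟨ expand j i ⟨
    L j (L i a)  ∎
    where
    expand : ∀ i j → L i (L j a) ≈ x * y * (D (x * y * D a) + j • 1# * (δ * D a))
                                   + i • 1# * (δ * (x * y * D a + j • 1# * (δ * a)))
    expand i j = +-cong
      (*-congˡ (trans (D.+-homo _ _) (+-congˡ (trans (D′.•-homo j _)
        (trans (•1 j _) (*-congˡ (D-constant* D-δ a)))))))
      (trans (•1 i _) (*-congˡ (*-congˡ (+-congˡ (•1 j _)))))

  ∏L-isAdditive : ∀ r → IsAdditive (∏ r L)
  ∏L-isAdditive = ∏-isAdditive L-isAdditive

  ∏L-constant* : ∀ {k} → D k ≈ 0# → ∀ r a → ∏ r L (k * a) ≈ k * ∏ r L a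
  ∏L-constant* {k} Dk≈0 = ∏-intertwine L-isAdditive (L-constant* Dk≈0)

  ∏L-L : ∀ r j a → ∏ r L (L j a) ≈ L j (∏ r L a)
  ∏L-L r j = ∏-intertwine L-isAdditive (λ i → L-comm i j) r

  ∏L-comm : ∀ r s a → ∏ r L (∏ s L a) ≈ ∏ s L (∏ r L a)
  ∏L-comm r s = ∏-intertwine L-isAdditive
    (λ j a → sym (∏L-L s j a)) r

  module _ (f : Carrier) where
    private
      T : ℕ → Carrier
      T i = x ^ suc i * (D ^∘ suc i) f

      w : ℕ → ℕ → Carrier
      w k i = ι ((k C i) /! suc i)

      𝒢-w : ∀ k → 𝒢 (suc k) f ≈ y ^ suc k * ∑[ i < suc k ] (w k (toℕ i) * T (toℕ i))
      𝒢-w k = *-congˡ (sum-cong R (suc k) (λ i → w k i * x ^ suc i * (D ^∘ suc i) f) (λ i → w k i * T i)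
        (λ i _ → *-assoc (w k i) (x ^ suc i) ((D ^∘ suc i) f)))

      -- `D` hits either the power of `x`, which brings down the exponent, or the iterated
      -- derivative, which shifts the index. So `x D` acts on the `T i` by a bidiagonal matrix.
      xD-T : ∀ i → x * D (T i) ≈ suc i • 1# * T i + T (suc i)
      xD-T i = begin
        x * D (x ^ suc i * h)
          ≈⟨ *-congˡ (trans (D.leibniz _ _) (+-congʳ (*-congʳ (D-^ D-x i)))) ⟩
        x * (suc i • 1# * x ^ i * h + x ^ suc i * D h)
          ≈⟨ solve 5 (λ x p ν h dh → x :* (ν :* p :* h :+ (x :* p) :* dh)
               := ν :* ((x :* p) :* h) :+ (x :* (x :* p)) :* dh) refl x (x ^ i) (suc i • 1#) h (D h) ⟩
        suc i • 1# * T i + T (suc i) ∎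
        where h = (D ^∘ suc i) f

      -- Allows the sum for `k` to be read over one more index, matching the length of the sum for
      -- `suc k`.
      w-outside : ∀ k → w k (suc k) ≈ 0#
      w-outside k = begin
        w k (suc k)                     ≈⟨ ι-/! (k C suc k) (suc (suc k)) ⟩
        (k C suc k) • 1/! suc (suc k)   ≈⟨ ×-congˡ (k>n⇒nCk≡0 (ℕ.n<1+n k)) ⟩
        0#                              ∎

      -- The binomial recurrence divided by `(i+2)!`. The factor `i + 2` on `C(k,i)` lowers the
      -- factorial to `(i+1)!`, the one belonging to `w k i`.
      w-recurrence : ∀ k i → suc (suc k) • w (suc k) (suc i)
                           ≈ (suc (suc i) ℕ.+ suc k) • w k (suc i) + w k i
      w-recurrence k i = begin
        suc (suc k) • w (suc k) (suc i)
          ≈⟨ ×-congʳ (suc (suc k)) (ι-/! (suc k C suc i) (2 ℕ.+ i)) ⟩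
        suc (suc k) • ((suc k C suc i) • e)
          ≈⟨ ×-assocˡ e (suc (suc k)) (suc k C suc i) ⟩
        (suc (suc k) ℕ.* (suc k C suc i)) • e
          ≈⟨ ×-congˡ ([n+2]*[n+1]C[k+1] k i) ⟩
        ((suc (suc i) ℕ.+ suc k) ℕ.* b ℕ.+ a ℕ.* suc (suc i)) • e
          ≈⟨ ×-homo-+ e ((suc (suc i) ℕ.+ suc k) ℕ.* b) (a ℕ.* suc (suc i)) ⟩
        ((suc (suc i) ℕ.+ suc k) ℕ.* b) • e + (a ℕ.* suc (suc i)) • e
          ≈⟨ +-cong (×-assocˡ e (suc (suc i) ℕ.+ suc k) b) (×-assocˡ e a (suc (suc i))) ⟨
        (suc (suc i) ℕ.+ suc k) • (b • e) + a • (suc (suc i) • e)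
          ≈⟨ +-cong (×-congʳ (suc (suc i) ℕ.+ suc k) (sym (ι-/! b (2 ℕ.+ i))))
                    (trans (×-congʳ a (suc•1/!suc (suc i))) (sym (ι-/! a (suc i)))) ⟩
        (suc (suc i) ℕ.+ suc k) • w k (suc i) + w k i ∎
        where
        a = k C i
        b = k C suc i
        e = 1/! suc (suc i)

      -- Comparison of coefficients of the `T i`: `x D + suc k` sends the `i`-th summand to `a i`, a
      -- multiple of `T i`, plus `b i`, a multiple of `T (suc i)`.
      sum-recurrence : ∀ k → let s = ∑[ i < suc k ] (w k (toℕ i) * T (toℕ i)) in
        suc (suc k) • ∑[ i < suc (suc k) ] (w (suc k) (toℕ i) * T (toℕ i))
        ≈ x * D s + suc k • s
      sum-recurrence k = begin
        suc (suc k) • ∑[ i < suc (suc k) ] (w (suc k) (toℕ i) * T (toℕ i))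
          ≈⟨ IsAdditive.sum-homo (•-isAdditive (suc (suc k))) (suc (suc k)) (t (suc k) ∘ toℕ) ⟩
        suc (suc k) • t (suc k) 0 + ∑[ i < suc k ] (suc (suc k) • t (suc k) (suc (toℕ i)))
          -- At index 0 both binomial coefficients compute to one and `suc 0 + suc k` to
          -- `suc (suc k)`, so this term is `a 0` up to bracketing.
          ≈⟨ +-cong (sym (×-assoc-* (suc (suc k)) _ _))
               (sum-cong R (suc k) (λ i → suc (suc k) • t (suc k) (suc i))
                 (λ i → a (suc i) + b i) (λ i _ → recurrence i)) ⟩
        a 0 + ∑[ i < suc k ] (a (suc (toℕ i)) + b (toℕ i))
          ≈⟨ trans (+-congˡ (∑-distrib-+ {suc k} (a ∘ suc ∘ toℕ) (b ∘ toℕ))) (sym (+-assoc _ _ _)) ⟩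
        ∑[ i < suc (suc k) ] a (toℕ i) + ∑[ i < suc k ] b (toℕ i)
          -- The last index carries `C(k,k+1)`, which is zero.
          ≈⟨ +-congʳ (trans (sum-last R (suc k) a) (trans (+-congˡ a-outside) (+-identityʳ _))) ⟩
        ∑[ i < suc k ] a (toℕ i) + ∑[ i < suc k ] b (toℕ i)
          ≈⟨ ∑-distrib-+ {suc k} (a ∘ toℕ) (b ∘ toℕ) ⟨
        ∑[ i < suc k ] (a (toℕ i) + b (toℕ i))
          ≈⟨ sum-cong R (suc k) (λ i → x * D (t k i) + suc k • t k i) (λ i → a i + b i) (λ i _ → summand i) ⟨
        ∑[ i < suc k ] (x * D (t k (toℕ i)) + suc k • t k (toℕ i))
          ≈⟨ IsAdditive.sum-homo
               (+-isAdditive (∘-isAdditive (*-isAdditive x) (derivation-isAdditive D-isDerivation))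
                 (•-isAdditive (suc k)))
               (suc k) (t k ∘ toℕ) ⟨
        x * D (∑[ i < suc k ] t k (toℕ i)) + suc k • ∑[ i < suc k ] t k (toℕ i) ∎
        where
        t : ℕ → ℕ → Carrier
        t k i = w k i * T i

        α a b : ℕ → Carrier
        α i = (suc i ℕ.+ suc k) • w k i
        a i = α i * T i
        b i = w k i * T (suc i)

        a-outside : a (suc k) ≈ 0#
        a-outside = trans (*-congʳ (trans (×-congʳ (suc (suc k) ℕ.+ suc k) (w-outside k))
          (IsAdditive.0-homo (•-isAdditive (suc (suc k) ℕ.+ suc k))))) (zeroˡ _)

        recurrence : ∀ i → suc (suc k) • t (suc k) (suc i) ≈ a (suc i) + b i
        recurrence i = begin
          suc (suc k) • (w (suc k) (suc i) * T (suc i))  ≈⟨ ×-assoc-* (suc (suc k)) _ _ ⟨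
          suc (suc k) • w (suc k) (suc i) * T (suc i)    ≈⟨ *-congʳ (w-recurrence k i) ⟩
          (α (suc i) + w k i) * T (suc i)                ≈⟨ distribʳ _ _ _ ⟩
          a (suc i) + b i                                ∎

        summand : ∀ i → x * D (t k i) + suc k • t k i ≈ a i + b i
        summand i = begin
          x * D (w k i * T i) + suc k • (w k i * T i)
            ≈⟨ +-cong (*-congˡ (D-constant* (D-ι _) (T i))) (•1 (suc k) _) ⟩
          x * (w k i * D (T i)) + suc k • 1# * (w k i * T i)
            ≈⟨ solve 5 (λ x w t dt κ → x :* (w :* dt) :+ κ :* (w :* t) := w :* (x :* dt) :+ κ :* (w :* t))
                 refl x (w k i) (T i) (D (T i)) (suc k • 1#) ⟩
          w k i * (x * D (T i)) + suc k • 1# * (w k i * T i)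
            ≈⟨ +-congʳ (*-congˡ (xD-T i)) ⟩
          w k i * (suc i • 1# * T i + T (suc i)) + suc k • 1# * (w k i * T i)
            ≈⟨ solve 5 (λ w t t′ ι κ → w :* (ι :* t :+ t′) :+ κ :* (w :* t) := (ι :+ κ) :* w :* t :+ w :* t′)
                 refl (w k i) (T i) (T (suc i)) (suc i • 1#) (suc k • 1#) ⟩
          (suc i • 1# + suc k • 1#) * w k i * T i + w k i * T (suc i)
            ≈⟨ +-congʳ (*-congʳ (trans (•1 (suc i ℕ.+ suc k) (w k i)) (*-congʳ (×-homo-+ 1# (suc i) (suc k))))) ⟨
          α i * T i + w k i * T (suc i) ∎

    -- Moving L r past y ^ r gives y ^ suc r * (x * D s + r • s): the term r • x * y ^ r * s
    -- produced by D (y ^ r) is cancelled by the x in δ = y - x.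
    𝒢-recurrence : ∀ r → suc r • 𝒢 (suc r) f ≈ L r (𝒢 r f)
    𝒢-recurrence zero = begin
      1 • (y * 1# * (ι 1ℚ * (x * 1#) * D f + 0#))
        ≈⟨ ×-congʳ 1 (*-congˡ (+-congʳ (*-congʳ (*-congʳ ι-1)))) ⟩
      1 • (y * 1# * (1# * (x * 1#) * D f + 0#))
        ≈⟨ solve 3 (λ x y df → (y :* con 1 :* (con 1 :* (x :* con 1) :* df :+ con 0)) :+ con 0
             := x :* y :* df :+ con 0) refl x y (D f) ⟩
      x * y * D f + 0# ∎
    𝒢-recurrence (suc k) = begin
      suc (suc k) • 𝒢 (suc (suc k)) f
        ≈⟨ ×-congʳ (suc (suc k)) (𝒢-w (suc k)) ⟩
      suc (suc k) • (y ^ suc (suc k) * ∑[ i < suc (suc k) ] (w (suc k) (toℕ i) * T (toℕ i)))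
        ≈⟨ ×-comm-* (suc (suc k)) _ _ ⟨
      y ^ suc (suc k) * (suc (suc k) • ∑[ i < suc (suc k) ] (w (suc k) (toℕ i) * T (toℕ i)))
        ≈⟨ *-congˡ (trans (sum-recurrence k) (+-congˡ (•1 (suc k) s))) ⟩
      y ^ suc (suc k) * (x * D s + suc k • 1# * s)
        ≈⟨ solve 6 (λ x y p s ds κ → y :* (y :* p) :* (x :* ds :+ κ :* s)
             := x :* y :* (y :* p :* ds) :+ κ :* (p :* (y :* s) :* y)) refl x y (y ^ k) s (D s) (suc k • 1#) ⟩
      x * y * (y * y ^ k * D s) + suc k • 1# * (y ^ k * (y * s) * y)
        ≈⟨ +-congˡ (*-congˡ (*-congˡ y≈δ+x)) ⟩
      x * y * (y * y ^ k * D s) + suc k • 1# * (y ^ k * (y * s) * (δ + x))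
        ≈⟨ solve 7 (λ x y δ p s ds κ →
             x :* y :* (y :* p :* ds) :+ κ :* (p :* (y :* s) :* (δ :+ x))
             := x :* y :* (κ :* p :* s :+ y :* p :* ds) :+ κ :* (δ :* (y :* p :* s)))
             refl x y δ (y ^ k) s (D s) (suc k • 1#) ⟩
      x * y * (suc k • 1# * y ^ k * s + y ^ suc k * D s) + suc k • 1# * (δ * (y ^ suc k * s))
        ≈⟨ +-cong (*-congˡ (trans (D.leibniz _ _) (+-congʳ (*-congʳ (D-^ D-y k))))) (•1 (suc k) _) ⟨
      L (suc k) (y ^ suc k * s)
        ≈⟨ IsAdditive.cong (L-isAdditive (suc k)) (𝒢-w k) ⟨
      L (suc k) (𝒢 (suc k) f) ∎
      where
      s = ∑[ i < suc k ] (w k (toℕ i) * T (toℕ i))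

  -- Induction on `r` after multiplication by `suc r`. The recurrence puts the new factor `L r`
  -- outermost while `∏` puts it innermost; commutation of the `L j` reconciles the two.
  𝒢-∏ : ∀ r f → 𝒢 r f ≈ 1/! r * ∏ r L f
  𝒢-∏ zero    f = sym (trans (*-congʳ ι-1) (*-identityˡ f))
  𝒢-∏ (suc r) f = •-cancel (suc r) (begin
    suc r • 𝒢 (suc r) f                  ≈⟨ 𝒢-recurrence f r ⟩
    L r (𝒢 r f)                          ≈⟨ IsAdditive.cong (L-isAdditive r) (𝒢-∏ r f) ⟩
    L r (1/! r * ∏ r L f)                ≈⟨ L-constant* (D-ι _) r _ ⟩
    1/! r * L r (∏ r L f)                ≈⟨ *-cong (suc•1/!suc r) (∏L-L r r f) ⟨
    (suc r • 1/! suc r) * ∏ (suc r) L f  ≈⟨ ×-assoc-* (suc r) _ _ ⟩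
    suc r • (1/! suc r * ∏ (suc r) L f)  ∎)

  !•𝒢-∏ : ∀ r f → (r !) • 𝒢 r f ≈ ∏ r L f
  !•𝒢-∏ r f = begin
    (r !) • 𝒢 r f                  ≈⟨ ×-congʳ (r !) (𝒢-∏ r f) ⟩
    (r !) • (1/! r * ∏ r L f)      ≈⟨ ×-assoc-* (r !) _ _ ⟨
    (r !) • 1/! r * ∏ r L f        ≈⟨ *-congʳ (!•1/! r) ⟩
    1# * ∏ r L f                   ≈⟨ *-identityˡ _ ⟩
    ∏ r L f                        ∎

  𝒢-comm : ∀ r s f → 𝒢 r (𝒢 s f) ≈ 𝒢 s (𝒢 r f)
  𝒢-comm r s f = begin
    𝒢 r (𝒢 s f)                          ≈⟨ 𝒢∘𝒢 r s ⟩
    1/! r * (1/! s * ∏ r L (∏ s L f))    ≈⟨ x∙yz≈y∙xz _ _ _ ⟩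
    1/! s * (1/! r * ∏ r L (∏ s L f))    ≈⟨ *-congˡ (*-congˡ (∏L-comm r s f)) ⟩
    1/! s * (1/! r * ∏ s L (∏ r L f))    ≈⟨ 𝒢∘𝒢 s r ⟨
    𝒢 s (𝒢 r f)                          ∎
    where
    open CommutativeSemigroupProperties *-commutativeSemigroup using (x∙yz≈y∙xz)
    𝒢∘𝒢 : ∀ r s → 𝒢 r (𝒢 s f) ≈ 1/! r * (1/! s * ∏ r L (∏ s L f))
    𝒢∘𝒢 r s = begin
      𝒢 r (𝒢 s f)                        ≈⟨ 𝒢-∏ r (𝒢 s f) ⟩
      1/! r * ∏ r L (𝒢 s f)              ≈⟨ *-congˡ (IsAdditive.cong (∏L-isAdditive r) (𝒢-∏ s f)) ⟩
      1/! r * ∏ r L (1/! s * ∏ s L f)    ≈⟨ *-congˡ (∏L-constant* (D-ι _) r _) ⟩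
      1/! r * (1/! s * ∏ r L (∏ s L f))  ∎

-- Formal power series in `z`.

module Convolution {c ℓ} (R : CommutativeRing c ℓ) (δ : CommutativeRing.Carrier R) where
  open CommutativeRing R hiding (zero)
  open SemiringMult semiring renaming (_×_ to _•_)
  open CommutativeMonoidSum +-commutativeMonoid using (∑-distrib-+)
  open SemiringSum semiring using (*-distribˡ-sum)
  open PowerSeries R
  open AdditiveOperators R
  open RingSolver commutativeSemiring using (solve; _:+_; _:*_; _:=_; con)
  open SetoidReasoning setoid

  Series : Set c
  Series = ℕ → Carrier

  infix 4 _≋_
  _≋_ : Series → Series → Set ℓ
  s ≋ t = ∀ n → s n ≈ t n

  infixl 6 _⊕_
  _⊕_ : Series → Series → Series
  (s ⊕ t) n = s n + t n

  -- θ = z d/dz, and σ is multiplication by δ z.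
  θ σ : Series → Series
  θ s n = n • s n
  σ s zero    = 0#
  σ s (suc n) = δ * s n

  σ-cong : ∀ {s t} → s ≋ t → σ s ≋ σ t
  σ-cong s≋t zero    = refl
  σ-cong s≋t (suc n) = *-congˡ (s≋t n)

  σ-⊕ : ∀ s t → σ s ⊕ σ t ≋ σ (s ⊕ t)
  σ-⊕ s t zero    = +-identityʳ 0#
  σ-⊕ s t (suc n) = sym (distribˡ δ (s n) (t n))

  ⊛-cong : ∀ {s s′ t t′} → s ≋ s′ → t ≋ t′ → s ⊛ t ≋ s′ ⊛ t′
  ⊛-cong {s} {s′} {t} {t′} s≋s′ t≋t′ n = sum-cong R (suc n)
    (λ i → s i * t (n ∸ i)) (λ i → s′ i * t′ (n ∸ i)) (λ i _ → *-cong (s≋s′ i) (t≋t′ (n ∸ i)))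

  ⊛-distribˡ : ∀ s t u → s ⊛ (t ⊕ u) ≋ (s ⊛ t) ⊕ (s ⊛ u)
  ⊛-distribˡ s t u n = trans
    (sum-cong R (suc n) (λ i → s i * (t (n ∸ i) + u (n ∸ i)))
      (λ i → s i * t (n ∸ i) + s i * u (n ∸ i)) (λ i _ → distribˡ (s i) (t (n ∸ i)) (u (n ∸ i))))
    (∑-distrib-+ {suc n} (λ i → s (toℕ i) * t (n ∸ toℕ i)) (λ i → s (toℕ i) * u (n ∸ toℕ i)))

  ⊛-distribʳ : ∀ s t u → (s ⊕ t) ⊛ u ≋ (s ⊛ u) ⊕ (t ⊛ u)
  ⊛-distribʳ s t u n = trans
    (sum-cong R (suc n) (λ i → (s i + t i) * u (n ∸ i))
      (λ i → s i * u (n ∸ i) + t i * u (n ∸ i)) (λ i _ → distribʳ (u (n ∸ i)) (s i) (t i)))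
    (∑-distrib-+ {suc n} (λ i → s (toℕ i) * u (n ∸ toℕ i)) (λ i → t (toℕ i) * u (n ∸ toℕ i)))

  ⊛-• : ∀ m s t → s ⊛ (λ i → m • t i) ≋ λ n → m • (s ⊛ t) n
  ⊛-• m s t n = trans
    (sum-cong R (suc n) (λ i → s i * (m • t (n ∸ i))) (λ i → m • (s i * t (n ∸ i)))
      (λ i _ → ×-comm-* m (s i) (t (n ∸ i))))
    (sym (IsAdditive.sum-homo (•-isAdditive m) (suc n) (λ i → s (toℕ i) * t (n ∸ toℕ i))))

  ⊛-zeroʳ : ∀ s → s ⊛ (λ _ → 0#) ≋ λ _ → 0#
  -- `0 • a` computes to `0#`.
  ⊛-zeroʳ s = ⊛-• 0 s (λ _ → 0#)

  ⊛-identityˡ : ∀ t → one ⊛ t ≋ t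
  ⊛-identityˡ t zero    = trans (+-identityʳ _) (*-identityˡ _)
  ⊛-identityˡ t (suc n) = begin
    1# * t (suc n) + ((λ _ → 0#) ⊛ t) n  ≈⟨ +-cong (*-identityˡ _) (begin
      -- Every product is zero, so the factors may be replaced by a constant series and the zero
      -- series in the order that `⊛-zeroʳ` expects.
      ((λ _ → 0#) ⊛ t) n  ≈⟨ sum-cong R (suc n) (λ i → 0# * t (n ∸ i)) (λ i → t n * 0#)
                               (λ i _ → trans (zeroˡ _) (sym (zeroʳ (t n)))) ⟩
      ((λ _ → t n) ⊛ (λ _ → 0#)) n  ≈⟨ ⊛-zeroʳ (λ _ → t n) n ⟩
      0#  ∎) ⟩
    t (suc n) + 0#                       ≈⟨ +-identityʳ _ ⟩
    t (suc n)                            ∎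

  σ-⊛ : ∀ s t → σ s ⊛ t ≋ σ (s ⊛ t)
  σ-⊛ s t zero    = trans (+-identityʳ _) (zeroˡ (t 0))
  σ-⊛ s t (suc n) = begin
    0# * t (suc n) + ((λ i → δ * s i) ⊛ t) n
      ≈⟨ trans (+-congʳ (zeroˡ (t (suc n)))) (+-identityˡ _) ⟩
    ((λ i → δ * s i) ⊛ t) n
      ≈⟨ sum-cong R (suc n) (λ i → δ * s i * t (n ∸ i)) (λ i → δ * (s i * t (n ∸ i)))
           (λ i _ → *-assoc δ (s i) (t (n ∸ i))) ⟩
    _
      ≈⟨ *-distribˡ-sum {suc n} δ (λ i → s (toℕ i) * t (n ∸ toℕ i)) ⟨
    δ * (s ⊛ t) n ∎

  -- Splitting off the leading coefficient of `s` lowers the degree by one. Degree one is separate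
  -- because the remaining convolution then has degree 0, where `σ` gives `0#`.
  ⊛-σ : ∀ s t → s ⊛ σ t ≋ σ (s ⊛ t)
  ⊛-σ s t zero          = trans (+-identityʳ _) (zeroʳ (s 0))
  ⊛-σ s t (suc zero)    = trans (+-congˡ (⊛-σ (s ∘ suc) t zero))
    (solve 3 (λ s δ t → s :* (δ :* t) :+ con 0 := δ :* (s :* t :+ con 0)) refl (s 0) δ (t 0))
  ⊛-σ s t (suc (suc n)) = trans (+-congˡ (⊛-σ (s ∘ suc) t (suc n)))
    (solve 4 (λ s δ t u → s :* (δ :* t) :+ δ :* u := δ :* (s :* t :+ u))
      refl (s 0) δ (t (suc n)) (((s ∘ suc) ⊛ t) n))

  -- The weight `n` splits as `i + (n ∸ i)` over the product of the coefficients of degrees `i` and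
  -- `n ∸ i`.
  θ-⊛ : ∀ s t → θ (s ⊛ t) ≋ (θ s ⊛ t) ⊕ (s ⊛ θ t)
  θ-⊛ s t n = begin
    n • (s ⊛ t) n
      ≈⟨ IsAdditive.sum-homo (•-isAdditive n) (suc n) (λ i → s (toℕ i) * t (n ∸ toℕ i)) ⟩
    _
      ≈⟨ sum-cong R (suc n) (λ i → n • (s i * t (n ∸ i)))
           (λ i → θ s i * t (n ∸ i) + s i * θ t (n ∸ i)) leibniz ⟩
    _
      ≈⟨ ∑-distrib-+ {suc n} (λ i → θ s (toℕ i) * t (n ∸ toℕ i)) (λ i → s (toℕ i) * θ t (n ∸ toℕ i)) ⟩
    (θ s ⊛ t) n + (s ⊛ θ t) n ∎
    where
    leibniz : ∀ i → i ℕ.< suc n → n • (s i * t (n ∸ i)) ≈ θ s i * t (n ∸ i) + s i * θ t (n ∸ i)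
    leibniz i (s≤s i≤n) = begin
      n • (s i * t (n ∸ i))
        ≡⟨ ≡.cong (_• (s i * t (n ∸ i))) (ℕ.m+[n∸m]≡n i≤n) ⟨
      (i ℕ.+ (n ∸ i)) • (s i * t (n ∸ i))
        ≈⟨ ×-homo-+ _ i (n ∸ i) ⟩
      i • (s i * t (n ∸ i)) + (n ∸ i) • (s i * t (n ∸ i))
        ≈⟨ +-cong (×-assoc-* i _ _) (×-comm-* (n ∸ i) _ _) ⟨
      θ s i * t (n ∸ i) + s i * θ t (n ∸ i) ∎

-- The exponential of `-log (1 - δz) E`.

module Exponential {c ℓ} (R : CommutativeRing c ℓ) (ι : ℚ → CommutativeRing.Carrier R)
  (ι-+ : ∀ p q → CommutativeRing._≈_ R (ι (p ℚ.+ q)) (CommutativeRing._+_ R (ι p) (ι q)))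
  (ι-1 : CommutativeRing._≈_ R (ι 1ℚ) (CommutativeRing.1# R))
  (δ : CommutativeRing.Carrier R) (a : ℕ → CommutativeRing.Carrier R)
  (a-zero : CommutativeRing._≈_ R (a 0) (CommutativeRing.0# R))
  (a-suc : ∀ m → CommutativeRing._≈_ R (a (suc m)) (CommutativeRing._*_ R (ι (+ 1 ℚ./ suc m))
    (SemiringExp._^_ (CommutativeRing.semiring R) δ (suc m)))) where
  open CommutativeRing R hiding (zero)
  open SemiringMult semiring renaming (_×_ to _•_)
  open SemiringExp semiring using () renaming (_^_ to _^ᴿ_)
  open CommutativeMonoidSum +-commutativeMonoid using (sum-syntax; ∑-distrib-+; sum-replicate-zero)
  open CommutativeSemigroupProperties +-commutativeSemigroup using (interchange)
  open Endo Carrier using () renaming (_^_ to _^∘_)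
  open PowerSeries R
  open AdditiveOperators R
  open Convolution R δ
  open ℚModule R ι ι-+ ι-1
  open RingSolver commutativeSemiring using (solve; _:+_; _:*_; _:=_; con)
  open SetoidReasoning setoid

  -- z a′ = δz (z a′ + 1), that is (1 - δz) a′ = δ.
  θ-a : θ a ≋ σ (θ a ⊕ one)
  θ-a zero          = refl
  θ-a (suc m) = trans (θa-suc m) (*-congˡ (δ^ m))
    where
    θa-suc : ∀ m → θ a (suc m) ≈ δ ^ᴿ suc m
    θa-suc m = begin
      suc m • a (suc m)                         ≈⟨ ×-congʳ (suc m) (a-suc m) ⟩
      suc m • (ι (+ 1 ℚ./ suc m) * δ ^ᴿ suc m)  ≈⟨ ×-assoc-* (suc m) _ _ ⟨
      suc m • ι (+ 1 ℚ./ suc m) * δ ^ᴿ suc m    ≈⟨ *-congʳ (•-ι-1/ (suc m)) ⟩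
      1# * δ ^ᴿ suc m                           ≈⟨ *-identityˡ _ ⟩
      δ ^ᴿ suc m                                ∎
    -- `θ a` is the geometric series in `δ z` without its constant term, which `one` restores.
    δ^ : ∀ m → δ ^ᴿ m ≈ θ a m + one m
    δ^ zero    = sym (+-identityˡ 1#)
    δ^ (suc m) = sym (trans (+-identityʳ _) (θa-suc m))

  θ-one : ∀ n → θ one n ≈ 0#
  θ-one zero    = refl
  θ-one (suc n) = IsAdditive.0-homo (•-isAdditive (suc n))

  -- n aⁿ⁻¹, the derivative of aⁿ with respect to a.
  ∂a : ℕ → Series
  ∂a zero    i = 0#
  ∂a (suc n) i = suc n • (a ^ n) i

  -- The product rule for `a * aⁿ` in the variable `a`; `suc n • _` unfolds to one copy plus `n`
  -- copies.
  ∂a-suc : ∀ n → (a ^ n) ⊕ (a ⊛ ∂a n) ≋ ∂a (suc n)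
  ∂a-suc zero    i = +-congˡ (⊛-zeroʳ a i)
  ∂a-suc (suc n) i = +-congˡ (⊛-• (suc n) a (a ^ n) i)

  -- (1 - δz) (aⁿ)′ = δ n aⁿ⁻¹
  θ-^ : ∀ n → θ (a ^ n) ≋ σ (θ (a ^ n) ⊕ ∂a n)
  θ-^ zero    zero    = refl
  θ-^ zero    (suc r) = begin
    θ one (suc r)             ≈⟨ θ-one (suc r) ⟩
    0#                        ≈⟨ zeroʳ δ ⟨
    δ * 0#                    ≈⟨ *-congˡ (trans (+-identityʳ _) (θ-one r)) ⟨
    δ * (θ one r + 0#)        ∎
  θ-^ (suc n) r = begin
    θ (a ⊛ P) r
      ≈⟨ θ-⊛ a P r ⟩
    (θ a ⊛ P) r + (a ⊛ θ P) r
      ≈⟨ +-cong (⊛-cong {t = P} θ-a (λ _ → refl) r) (⊛-cong {s = a} (λ _ → refl) (θ-^ n) r) ⟩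
    (σ (θ a ⊕ one) ⊛ P) r + (a ⊛ σ (θ P ⊕ ∂a n)) r
      ≈⟨ +-cong (σ-⊛ (θ a ⊕ one) P r) (⊛-σ a (θ P ⊕ ∂a n) r) ⟩
    σ ((θ a ⊕ one) ⊛ P) r + σ (a ⊛ (θ P ⊕ ∂a n)) r
      ≈⟨ σ-⊕ ((θ a ⊕ one) ⊛ P) (a ⊛ (θ P ⊕ ∂a n)) r ⟩
    σ ((θ a ⊕ one) ⊛ P ⊕ a ⊛ (θ P ⊕ ∂a n)) r
      ≈⟨ σ-cong regroup r ⟩
    σ (θ (a ⊛ P) ⊕ ∂a (suc n)) r ∎
    where
    P = a ^ n
    regroup : (θ a ⊕ one) ⊛ P ⊕ a ⊛ (θ P ⊕ ∂a n) ≋ θ (a ⊛ P) ⊕ ∂a (suc n)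
    regroup i = begin
      ((θ a ⊕ one) ⊛ P) i + (a ⊛ (θ P ⊕ ∂a n)) i
        ≈⟨ +-cong (⊛-distribʳ (θ a) one P i) (⊛-distribˡ a (θ P) (∂a n) i) ⟩
      ((θ a ⊛ P) i + (one ⊛ P) i) + ((a ⊛ θ P) i + (a ⊛ ∂a n) i)
        ≈⟨ interchange _ _ _ _ ⟩
      ((θ a ⊛ P) i + (a ⊛ θ P) i) + ((one ⊛ P) i + (a ⊛ ∂a n) i)
        ≈⟨ +-cong (sym (θ-⊛ a P i)) (trans (+-congʳ (⊛-identityˡ P i)) (∂a-suc n i)) ⟩
      θ (a ⊛ P) i + ∂a (suc n) i ∎

  module _ {E : Carrier → Carrier} (E-isAdditive : IsAdditive E) where
    private
      module E = IsAdditive E-isAdditive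

    term : ℕ → ℕ → Carrier → Carrier
    term n r g = 1/! n * ((a ^ n) r * (E ^∘ n) g)

    -- Iterates grow by an `E` on the outside, whereas `term-suc` hands an `E` to the argument.
    ^∘-suc : ∀ n g → (E ^∘ n) (E g) ≡ (E ^∘ suc n) g
    ^∘-suc zero    g = ≡.refl
    ^∘-suc (suc n) g = ≡.cong E (^∘-suc n g)

    -- Both sides vanish, since `a ^ 0` is constant in `z`. The right side is written so as to
    -- supply the index 0 of a sum of `r • term n r g`.
    term-zero : ∀ r g → suc r • term 0 (suc r) g ≈ δ * (r • term 0 r g)
    term-zero r g = begin
      suc r • (1/! 0 * (0# * g))           ≈⟨ ×-congʳ (suc r) (trans (*-congˡ (zeroˡ g)) (zeroʳ _)) ⟩
      suc r • 0#                           ≈⟨ IsAdditive.0-homo (•-isAdditive (suc r)) ⟩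
      0#                                   ≈⟨ solve 3 (λ δ e g → con 0 := δ :* (e :* (con 0 :* g))) refl δ (1/! 0) g ⟩
      δ * (1/! 0 * (0# * g))               ≈⟨ *-congˡ (*-congˡ (*-congʳ (θ-one r))) ⟨
      δ * (1/! 0 * (r • one r * g))        ≈⟨ *-congˡ (trans (*-congˡ (×-assoc-* r _ _)) (×-comm-* r _ _)) ⟩
      δ * (r • (1/! 0 * (one r * g)))      ∎

    -- The coefficient of degree `suc r` in `θ-^ (suc n)`. The factor `suc n` from `∂a` turns
    -- `1/(n+1)!` into `1/n!`, leaving one `E` too many for `term n`; it goes to the argument.
    term-suc : ∀ n r g → suc r • term (suc n) (suc r) g ≈ δ * (r • term (suc n) r g + term n r (E g))
    term-suc n r g = begin
      suc r • (e * ((a ^ suc n) (suc r) * h))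
        ≈⟨ ×-comm-* (suc r) _ _ ⟨
      e * (suc r • ((a ^ suc n) (suc r) * h))
        ≈⟨ *-congˡ (×-assoc-* (suc r) _ h) ⟨
      e * (θ (a ^ suc n) (suc r) * h)
        ≈⟨ *-congˡ (*-congʳ (θ-^ (suc n) (suc r))) ⟩
      e * (δ * (r • (a ^ suc n) r + suc n • (a ^ n) r) * h)
        ≈⟨ *-congˡ (*-congʳ (*-congˡ (+-cong (•1 r _) (•1 (suc n) _)))) ⟩
      e * (δ * (r • 1# * (a ^ suc n) r + suc n • 1# * (a ^ n) r) * h)
        ≈⟨ solve 7 (λ e δ ρ A ν B h → e :* (δ :* (ρ :* A :+ ν :* B) :* h)
             := δ :* (ρ :* (e :* (A :* h)) :+ ν :* e :* (B :* h)))
             refl e δ (r • 1#) ((a ^ suc n) r) (suc n • 1#) ((a ^ n) r) h ⟩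
      δ * (r • 1# * term (suc n) r g + suc n • 1# * e * ((a ^ n) r * h))
        ≈⟨ *-congˡ (+-cong (•1 r _) (*-cong (trans (sym (suc•1/!suc n)) (•1 (suc n) e))
             (*-congˡ (reflexive (^∘-suc n g))))) ⟨
      δ * (r • term (suc n) r g + term n r (E g)) ∎
      where
      e = 1/! suc n
      h = (E ^∘ suc n) g

    -- Induction on `r` with `M` and `g` free: the step uses degree `r` for `g` up to index `suc M`
    -- and for `E g` up to index `M`. The vanishing constant term of `a` enters in degree 0, where
    -- it kills every term with positive index.
    exponential : ∀ r M g → r ≤ M →
      ∑[ n < suc M ] term (toℕ n) r g ≈ 1/! r * (δ ^ᴿ r * ∏ r (E ⊞_) g)
    exponential zero    M g _ = begin
      1/! 0 * (1# * g) + ∑[ n < M ] term (suc (toℕ n)) 0 g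
        ≈⟨ +-congˡ (trans (sum-cong R M (λ n → term (suc n) 0 g) (λ _ → 0#) (λ n _ → vanishes n))
             (sum-replicate-zero M)) ⟩
      1/! 0 * (1# * g) + 0#
        ≈⟨ +-identityʳ _ ⟩
      1/! 0 * (1# * g) ∎
      where
      vanishes : ∀ n → term (suc n) 0 g ≈ 0#
      vanishes n = trans (*-congˡ (*-congʳ (+-congʳ (*-congʳ a-zero))))
        (solve 3 (λ e A h → e :* ((con 0 :* A :+ con 0) :* h) := con 0)
          refl (1/! suc n) ((a ^ n) 0) ((E ^∘ suc n) g))
    exponential (suc r) (suc M) g (s≤s r≤M) = •-cancel (suc r) (begin
      suc r • ∑[ n < suc (suc M) ] term (toℕ n) (suc r) g
        ≈⟨ IsAdditive.sum-homo (•-isAdditive (suc r)) (suc (suc M)) (λ n → term (toℕ n) (suc r) g) ⟩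
      suc r • term 0 (suc r) g + ∑[ n < suc M ] (suc r • term (suc (toℕ n)) (suc r) g)
        ≈⟨ +-cong (term-zero r g) (trans
             (sum-cong R (suc M) (λ n → suc r • term (suc n) (suc r) g)
               (λ n → δ * (r • term (suc n) r g + term n r (E g))) (λ n _ → term-suc n r g))
             (sym (IsAdditive.sum-homo (*-isAdditive δ) (suc M)
               (λ n → r • term (suc (toℕ n)) r g + term (toℕ n) r (E g))))) ⟩
      δ * (r • term 0 r g) + δ * ∑[ n < suc M ] (r • term (suc (toℕ n)) r g + term (toℕ n) r (E g))
        ≈⟨ distribˡ δ _ _ ⟨
      δ * (r • term 0 r g + ∑[ n < suc M ] (r • term (suc (toℕ n)) r g + term (toℕ n) r (E g)))
        -- The isolated term is the missing index 0 of the first sum, which thus has one more index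
        -- than the second.
        ≈⟨ *-congˡ (trans (+-congˡ (∑-distrib-+ {suc M} (λ n → r • term (suc (toℕ n)) r g)
             (λ n → term (toℕ n) r (E g)))) (sym (+-assoc _ _ _))) ⟩
      δ * (∑[ n < suc (suc M) ] (r • term (toℕ n) r g) + ∑[ n < suc M ] term (toℕ n) r (E g))
        ≈⟨ *-congˡ (+-congʳ (IsAdditive.sum-homo (•-isAdditive r) (suc (suc M)) (λ n → term (toℕ n) r g))) ⟨
      δ * (r • ∑[ n < suc (suc M) ] term (toℕ n) r g + ∑[ n < suc M ] term (toℕ n) r (E g))
        ≈⟨ *-congˡ (+-cong (×-congʳ r (exponential r (suc M) g (ℕ.m≤n⇒m≤1+n r≤M))) (exponential r M (E g) r≤M)) ⟩
      δ * (r • (e * (d * Π g)) + e * (d * Π (E g)))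
        ≈⟨ *-congˡ (+-congʳ (•1 r _)) ⟩
      δ * (r • 1# * (e * (d * Π g)) + e * (d * Π (E g)))
        ≈⟨ solve 6 (λ δ ρ e d p q → δ :* (ρ :* (e :* (d :* p)) :+ e :* (d :* q))
             := e :* (δ :* d :* (q :+ ρ :* p))) refl δ (r • 1#) e d (Π g) (Π (E g)) ⟩
      e * (δ * d * (Π (E g) + r • 1# * Π g))
        -- Additivity of `Π` merges the two terms into `Π ((E ⊞ r) g)`, whose `E ⊞ r` is the new
        -- innermost factor.
        ≈⟨ *-congˡ (*-congˡ (+-congˡ (trans (Π.•-homo r g) (•1 r _)))) ⟨
      e * (δ * d * (Π (E g) + Π (r • g)))
        ≈⟨ *-congˡ (*-congˡ (Π.+-homo (E g) (r • g))) ⟨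
      e * (δ * d * Π ((E ⊞ r) g))
        ≈⟨ *-congʳ (suc•1/!suc r) ⟨
      suc r • 1/! suc r * (δ * d * Π ((E ⊞ r) g))
        ≈⟨ ×-assoc-* (suc r) _ _ ⟩
      suc r • (1/! suc r * (δ ^ᴿ suc r * ∏ (suc r) (E ⊞_) g)) ∎)
      where
      e = 1/! r
      d = δ ^ᴿ r
      Π = ∏ r (E ⊞_)
      module Π = IsAdditive (∏-isAdditive (⊞-isAdditive E-isAdditive) r)

    -- Here `M` counts the terms, whereas in `exponential` it is the largest index; hence the bound
    -- `suc r`.
    exponential-sum : ∀ r g {s} (t : ℕ → Carrier) → (∀ n → t n ≈ term n r g) →
      s ≈ 1/! r * (δ ^ᴿ r * ∏ r (E ⊞_) g) → ∀ M → suc r ≤ M → s ≈ ∑[ n < M ] t (toℕ n)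
    exponential-sum r g {s} t t≈term s≈exp (suc M) (s≤s r≤M) = begin
      s                                  ≈⟨ s≈exp ⟩
      1/! r * (δ ^ᴿ r * ∏ r (E ⊞_) g)        ≈⟨ exponential r M g r≤M ⟨
      ∑[ n < suc M ] term (toℕ n) r g    ≈⟨ sum-cong R (suc M) t (λ n → term n r g) (λ n _ → t≈term n) ⟨
      ∑[ n < suc M ] t (toℕ n)           ∎

-- Induction on polynomials.

module _ {c ℓ} (R : CommutativeRing c ℓ) where
  open Polynomial R
  private
    module R = CommutativeRing R

  horner : ∀ a p → a ∷ p ≈ const a + X * p
  horner a p = ≈-sym (≈-trans
    (+-cong (≈-refl {const a}) (≈-trans (0∷-* (const R.1#) p) (∷-cong R.refl (*-identityˡ p))))
    (∷-cong (R.+-identityʳ a) ≈-refl))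

-- Horner's scheme twice: in `x` for each coefficient, then in `y`. Invariance of `Q` under `≈` is
-- used because a coefficient list is only `≈` to its Horner form.
ℚ[x,y]-induction : ∀ {q} (Q : P.Carrier → Set q) → (∀ {f g} → f P.≈ g → Q g → Q f) →
  (∀ f g → Q f → Q g → Q (f P.+ g)) → (∀ f g → Q f → Q g → Q (f P.* g)) →
  (∀ c → Q (P.ι c)) → Q P.x → Q P.y → ∀ f → Q f
ℚ[x,y]-induction Q Q-cong Q-+ Q-* Q-ι Q-x Q-y = Q-poly
  where
  ℚ-ring = IntegralDomain.commutativeRing ℚ-integralDomain
  module ℚ[x] = Polynomial ℚ-ring
  module ℚ[x][y] = Polynomial ℚ[x].commutativeRing

  -- Zero is the empty list, which differs from `P.ι 0ℚ` by trailing zeros.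
  Q-0 : Q P.0#
  Q-0 = Q-cong
    (ℚ[x][y].≈-sym (ℚ[x][y].≈-trans (ℚ[x][y].∷-cong ℚ[x].0∷[]≈[] ℚ[x][y].≈-refl) ℚ[x][y].0∷[]≈[]))
    (Q-ι 0ℚ)

  Q-const : ∀ p → Q (ℚ[x][y].const p)
  Q-const []      = Q-cong ℚ[x][y].0∷[]≈[] Q-0
  Q-const (c ∷ p) = Q-cong
    (ℚ[x][y].≈-trans (ℚ[x][y].∷-cong (horner ℚ-ring c p) ℚ[x][y].≈-refl)
      (ℚ[x][y].+-cong (ℚ[x][y].≈-refl {P.ι c}) (ℚ[x][y].≈-sym (ℚ[x][y].const-* ℚ[x].X (ℚ[x][y].const p)))))
    (Q-+ (P.ι c) (P.x P.* ℚ[x][y].const p) (Q-ι c) (Q-* P.x (ℚ[x][y].const p) Q-x (Q-const p)))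

  Q-poly : ∀ f → Q f
  Q-poly []      = Q-0
  Q-poly (p ∷ f) = Q-cong (horner ℚ[x].commutativeRing p f)
    (Q-+ (ℚ[x][y].const p) (P.y P.* f) (Q-const p) (Q-* P.y f Q-y (Q-poly f)))

-- Comparison of `δ E` with `xyD`.

-- A stands for ℚ[x,y], K for ℚ(x,y) and h for the inclusion of A in K.
module Euler {a ℓa k ℓk} (A : CommutativeRing a ℓa) (K : CommutativeRing k ℓk)
  (h : CommutativeRing.Carrier A → CommutativeRing.Carrier K)
  (h-cong : ∀ {f g} → CommutativeRing._≈_ A f g → CommutativeRing._≈_ K (h f) (h g))
  (h-+ : ∀ f g → CommutativeRing._≈_ K (h (CommutativeRing._+_ A f g)) (CommutativeRing._+_ K (h f) (h g)))
  (h-* : ∀ f g → CommutativeRing._≈_ K (h (CommutativeRing._*_ A f g)) (CommutativeRing._*_ K (h f) (h g)))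
  (x y δ : CommutativeRing.Carrier A)
  (y≈δ+x : CommutativeRing._≈_ A y (CommutativeRing._+_ A δ x))
  {D : CommutativeRing.Carrier A → CommutativeRing.Carrier A} (D-isDerivation : IsDerivation A D)
  (D-x : CommutativeRing._≈_ A (D x) (CommutativeRing.1# A))
  (D-y : CommutativeRing._≈_ A (D y) (CommutativeRing.1# A))
  {E : CommutativeRing.Carrier K → CommutativeRing.Carrier K} (E-isDerivation : IsDerivation K E)
  (E-δ : CommutativeRing._≈_ K (E (h δ)) (CommutativeRing.0# K))
  {u : CommutativeRing.Carrier K} (E-u : CommutativeRing._≈_ K (E u) u)
  (x≈uy : CommutativeRing._≈_ K (h x) (CommutativeRing._*_ K u (h y))) where
  private
    module A = CommutativeRing A
    module D = IsDerivation D-isDerivation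
    module E = IsDerivation E-isDerivation
  open CommutativeRing K hiding (zero)
  open SemiringMult semiring renaming (_×_ to _•_)
  open SemiringMult A.semiring using () renaming (_×_ to _•ᴬ_)
  open SemiringExp semiring using (_^_)
  open RingProperties ring
  open AdditiveOperators K
  open RingSolver commutativeSemiring using (solve; _:+_; _:*_; _:=_)
  open SetoidReasoning setoid

  h-0 : h A.0# ≈ 0#
  h-0 = +-identityˡ-unique _ _ (trans (sym (h-+ A.0# A.0#)) (h-cong (A.+-identityʳ A.0#)))

  h-• : ∀ n f → h (n •ᴬ f) ≈ n • h f
  h-• zero    f = h-0
  h-• (suc n) f = trans (h-+ f (n •ᴬ f)) (+-congˡ (h-• n f))

  private
    xyD : A.Carrier → A.Carrier
    xyD f = x A.* y A.* D f

    y≈δ+x′ : h y ≈ h δ + h x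
    y≈δ+x′ = trans (h-cong y≈δ+x) (h-+ δ x)

    E-y : E (h y) ≈ E (h x)
    E-y = begin
      E (h y)            ≈⟨ E.cong y≈δ+x′ ⟩
      E (h δ + h x)      ≈⟨ E.+-homo (h δ) (h x) ⟩
      E (h δ) + E (h x)  ≈⟨ +-congʳ E-δ ⟩
      0# + E (h x)       ≈⟨ +-identityˡ _ ⟩
      E (h x)            ∎

    Agree : A.Carrier → Set ℓk
    Agree f = h δ * E (h f) ≈ h (xyD f)

    -- From y E x = y E (u y) = y (x + u E x) = x y + x E x and y = δ + x.
    δ*E-x : h δ * E (h x) ≈ h x * h y
    δ*E-x = +-cancelʳ (h x * E (h x)) _ _ (begin
      h δ * E (h x) + h x * E (h x)      ≈⟨ distribʳ (E (h x)) (h δ) (h x) ⟨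
      (h δ + h x) * E (h x)              ≈⟨ *-cong (sym y≈δ+x′) (E.cong x≈uy) ⟩
      h y * E (u * h y)                  ≈⟨ *-congˡ (E.leibniz u (h y)) ⟩
      h y * (E u * h y + u * E (h y))    ≈⟨ *-congˡ (+-cong (*-congʳ E-u) (*-congˡ E-y)) ⟩
      h y * (u * h y + u * E (h x))
        ≈⟨ solve 3 (λ y u e → y :* (u :* y :+ u :* e) := u :* y :* y :+ u :* y :* e) refl (h y) u (E (h x)) ⟩
      u * h y * h y + u * h y * E (h x)  ≈⟨ +-cong (*-congʳ x≈uy) (*-congʳ x≈uy) ⟨
      h x * h y + h x * E (h x)          ∎)

    agree-generator : ∀ {t} → D t A.≈ A.1# → E (h t) ≈ E (h x) → Agree t
    agree-generator {t} Dt≈1 Et≈Ex = begin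
      h δ * E (h t)        ≈⟨ *-congˡ Et≈Ex ⟩
      h δ * E (h x)        ≈⟨ δ*E-x ⟩
      h x * h y            ≈⟨ h-* x y ⟨
      h (x A.* y)          ≈⟨ h-cong (A.trans (A.*-congˡ Dt≈1) (A.*-identityʳ (x A.* y))) ⟨
      h (x A.* y A.* D t)  ∎

    agree-constant : ∀ {t} → D t A.≈ A.0# → E (h t) ≈ 0# → Agree t
    agree-constant {t} Dt≈0 Et≈0 = begin
      h δ * E (h t)        ≈⟨ trans (*-congˡ Et≈0) (zeroʳ (h δ)) ⟩
      0#                   ≈⟨ h-0 ⟨
      h A.0#               ≈⟨ h-cong (A.trans (A.*-congˡ Dt≈0) (A.zeroʳ (x A.* y))) ⟨
      h (x A.* y A.* D t)  ∎

    agree-cong : ∀ {f g} → f A.≈ g → Agree g → Agree f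
    agree-cong f≈g e = trans (*-congˡ (E.cong (h-cong f≈g)))
      (trans e (h-cong (A.*-congˡ (D.cong (A.sym f≈g)))))

    agree-+ : ∀ f g → Agree f → Agree g → Agree (f A.+ g)
    agree-+ f g e e′ = begin
      h δ * E (h (f A.+ g))                ≈⟨ *-congˡ (trans (E.cong (h-+ f g)) (E.+-homo _ _)) ⟩
      h δ * (E (h f) + E (h g))            ≈⟨ distribˡ _ _ _ ⟩
      h δ * E (h f) + h δ * E (h g)        ≈⟨ +-cong e e′ ⟩
      h (xyD f) + h (xyD g)                ≈⟨ h-+ _ _ ⟨
      h (xyD f A.+ xyD g)                  ≈⟨ h-cong (A.trans (A.*-congˡ (D.+-homo f g)) (A.distribˡ _ _ _)) ⟨
      h (xyD (f A.+ g))                    ∎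

    -- `δ E` and `xyD` are multiples of derivations by a ring element, hence derivations, so their
    -- Leibniz expansions match term by term.
    agree-* : ∀ f g → Agree f → Agree g → Agree (f A.* g)
    agree-* f g e e′ = begin
      h δ * E (h (f A.* g))
        ≈⟨ *-congˡ (E.cong (h-* f g)) ⟩
      h δ * E (h f * h g)
        ≈⟨ δE.leibniz (h f) (h g) ⟩
      h δ * E (h f) * h g + h f * (h δ * E (h g))
        ≈⟨ +-cong (*-congʳ e) (*-congˡ e′) ⟩
      h (xyD f) * h g + h f * h (xyD g)
        ≈⟨ trans (h-+ _ _) (+-cong (h-* _ _) (h-* _ _)) ⟨
      h (xyD f A.* g A.+ f A.* xyD g)
        ≈⟨ h-cong (xyD.leibniz f g) ⟨
      h (xyD (f A.* g)) ∎
      where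
      module δE = IsDerivation (*-isDerivation K (h δ) E-isDerivation)
      module xyD = IsDerivation (*-isDerivation A (x A.* y) D-isDerivation)

  module _
    (ι : ℚ → A.Carrier) (D-ι : ∀ q → D (ι q) A.≈ A.0#) (E-ι : ∀ q → E (h (ι q)) ≈ 0#)
    (induction : ∀ {q} (Q : A.Carrier → Set q) → (∀ {f g} → f A.≈ g → Q g → Q f) →
      (∀ f g → Q f → Q g → Q (f A.+ g)) → (∀ f g → Q f → Q g → Q (f A.* g)) →
      (∀ c → Q (ι c)) → Q x → Q y → ∀ f → Q f) where

    δ*E : ∀ f → h δ * E (h f) ≈ h (x A.* y A.* D f)
    δ*E = induction Agree agree-cong agree-+ agree-* (λ q → agree-constant (D-ι q) (E-ι q))
      (agree-generator D-x refl) (agree-generator D-y E-y)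

    private
      E⊞j-isAdditive : ∀ j → IsAdditive (E ⊞ j)
      E⊞j-isAdditive = ⊞-isAdditive (derivation-isAdditive E-isDerivation)

    ⊞-δ* : ∀ j g → (E ⊞ j) (h δ * g) ≈ h δ * (E ⊞ j) g
    ⊞-δ* j g = begin
      E (h δ * g) + j • (h δ * g)
        ≈⟨ +-cong (E.leibniz (h δ) g) (sym (×-comm-* j (h δ) g)) ⟩
      (E (h δ) * g + h δ * E g) + h δ * (j • g)
        ≈⟨ +-congʳ (trans (+-congʳ (trans (*-congʳ E-δ) (zeroˡ g))) (+-identityˡ _)) ⟩
      h δ * E g + h δ * (j • g)
        ≈⟨ distribˡ (h δ) (E g) (j • g) ⟨
      h δ * (E g + j • g) ∎

    δ*[E⊞j] : ∀ j f → h δ * (E ⊞ j) (h f) ≈ h (x A.* y A.* D f A.+ j •ᴬ (δ A.* f))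
    δ*[E⊞j] j f = begin
      h δ * (E (h f) + j • h f)                        ≈⟨ distribˡ _ _ _ ⟩
      h δ * E (h f) + h δ * (j • h f)                  ≈⟨ +-cong (δ*E f) (×-comm-* j (h δ) (h f)) ⟩
      h (xyD f) + j • (h δ * h f)                      ≈⟨ +-congˡ (×-congʳ j (h-* δ f)) ⟨
      h (xyD f) + j • h (δ A.* f)                      ≈⟨ +-congˡ (h-• j (δ A.* f)) ⟨
      h (xyD f) + h (j •ᴬ (δ A.* f))                   ≈⟨ h-+ _ _ ⟨
      h (xyD f A.+ j •ᴬ (δ A.* f))                     ∎

    -- `E` alone leads out of the polynomials, but `δ (E + j)` maps them to themselves. So each
    -- factor first takes one `δ`, and the product is then computed inside the image of `h`.
    δ^*∏[E⊞j] : ∀ r f → h δ ^ r * ∏ r (E ⊞_) (h f) ≈ h (∏ r (λ j g → x A.* y A.* D g A.+ j •ᴬ (δ A.* g)) f)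
    δ^*∏[E⊞j] r f = trans (∏-scale (h δ) E⊞j-isAdditive ⊞-δ* r (h f))
      (∏-intertwine (λ j → ∘-isAdditive (*-isAdditive (h δ)) (E⊞j-isAdditive j)) δ*[E⊞j] r f)

-- Specialisation to polynomials and rational functions.

module ℚ[x,y] = DifferentialAlgebra P.commutativeRing P.ι (λ _ _ → P.refl) P.refl
  P.x P.y P.D P.D-isDerivation P.D-ι P.D-x P.D-y

D-embed : ∀ f {g} → P.D f P.≈ g → K.D (K.embed f) K.≈ K.embed g
D-embed f Df≈g = K.trans (K.D-embed f) (K.embed-cong Df≈g)

ι-+ : ∀ p q → K.ι (p ℚ.+ q) K.≈ K.ι p K.+ K.ι q
ι-+ p q = K.embed-+ (P.ι p) (P.ι q)

-- The same argument over the field of fractions gives the commutation of the `𝒢 r` there, rather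
-- than a passage from polynomials to quotients.
module ℚ⟨x,y⟩ = DifferentialAlgebra K.commutativeRing K.ι ι-+ K.refl
  K.x K.y K.D K.D-isDerivation (λ q → D-embed (P.ι q) (P.D-ι q)) (D-embed P.x P.D-x) (D-embed P.y P.D-y)

x≈u*y : K.x K.≈ K.u K.* K.y
x≈u*y = K.mk≈ (solve 2 (λ x y → x :* (y :* con 1) := x :* y :* con 1) P.refl P.x P.y)
  where open RingSolver P.commutativeSemiring using (solve; _:*_; _:=_; con)

module _ {E : K.Carrier → K.Carrier} (E-isU∂ᵤ : K.IsU∂ᵤ E) where
  private
    module E = K.IsU∂ᵤ E-isU∂ᵤ

  δ^*∏[E⊞j]j : ∀ r f → K.δ K.^ r K.* ∏ r (λ j g → E g K.+ j K.• g) (K.embed f) K.≈ K.embed (∏ r ℚ[x,y].L f)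
  δ^*∏[E⊞j]j = Euler.δ^*∏[E⊞j] P.commutativeRing K.commutativeRing K.embed K.embed-cong K.embed-+ K.embed-*
    P.x P.y P.δ ℚ[x,y].y≈δ+x P.D-isDerivation P.D-x P.D-y E.isDerivation E.E-δ E.E-u x≈u*y
    P.ι P.D-ι E.constant ℚ[x,y]-induction

  embed-𝒢 : ∀ r f → K.embed (P.𝒢 r f)
    K.≈ K.ι (1 /! r) K.* (K.δ K.^ r K.* ∏ r (λ j g → E g K.+ j K.• g) (K.embed f))
  embed-𝒢 r f = begin
    K.embed (P.𝒢 r f)
      ≈⟨ K.embed-cong (ℚ[x,y].𝒢-∏ r f) ⟩
    K.embed (P.ι (1 /! r) P.* ∏ r ℚ[x,y].L f)
      ≈⟨ K.embed-* (P.ι (1 /! r)) (∏ r ℚ[x,y].L f) ⟩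
    K.ι (1 /! r) K.* K.embed (∏ r ℚ[x,y].L f)
      ≈⟨ K.*-congˡ {K.ι (1 /! r)} (δ^*∏[E⊞j]j r f) ⟨
    K.ι (1 /! r) K.* (K.δ K.^ r K.* ∏ r (λ j g → E g K.+ j K.• g) (K.embed f)) ∎
    where open SetoidReasoning K.setoid

  private
    module Exp = Exponential K.commutativeRing K.ι ι-+ K.refl K.δ -log[1-δz] K.refl (λ _ → K.refl)

    E-isAdditive : AdditiveOperators.IsAdditive K.commutativeRing E
    E-isAdditive = record { cong = E.cong ; +-homo = E.+-homo }

  -- The witness is `suc r`: `a` has no constant term, so `a ^ n` contributes to degree `r` only for
  -- `n` at most `r`.
  embed-𝒢-isSumOf : (λ r f → K.embed (P.𝒢 r f)) isSumOf expTerm -log[1-δz] E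
  embed-𝒢-isSumOf r = suc r , λ M r<M f → Exp.exponential-sum E-isAdditive r (K.embed f)
    (λ n → expTerm -log[1-δz] E n r f) (λ _ → K.refl) (embed-𝒢 r f) M r<M

theorem6 : (∀ (E : K.Carrier → K.Carrier) → K.IsU∂ᵤ E →
    ((λ r f → K.embed (P.𝒢 r f)) isSumOf expTerm -log[1-δz] E)
    ×
    (∀ r → 1 ≤ r → ∀ f →
    K.embed (P.𝒢 r f)
    K.≈ K.ι (1 /! r) K.* K.δ K.^ r K.* ∏ r (λ j g → E g K.+ j K.• g) (K.embed f)))
    ×
    (∀ r → 1 ≤ r → ∀ f →
    (r !) P.• P.𝒢 r f
    P.≈ ∏ r (λ j g → P.x P.* P.y P.* P.D g P.+ j P.• (P.δ P.* g)) f)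
    ×
    (∀ r s f → P.𝒢 r (P.𝒢 s f) P.≈ P.𝒢 s (P.𝒢 r f))
    ×
    (∀ r s f → K.𝒢 r (K.𝒢 s f) K.≈ K.𝒢 s (K.𝒢 r f))
theorem6 =
    (λ E E-isU∂ᵤ → embed-𝒢-isSumOf E-isU∂ᵤ , λ r _ f → K.trans (embed-𝒢 E-isU∂ᵤ r f)
      (K.sym (K.*-assoc (K.ι (1 /! r)) (K.δ K.^ r) (∏ r (λ j g → E g K.+ j K.• g) (K.embed f)))))
  , (λ r _ f → ℚ[x,y].!•𝒢-∏ r f)
  , ℚ[x,y].𝒢-comm
  , ℚ⟨x,y⟩.𝒢-comm
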